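{- Let $\Gamma$ be a connected $3$-valent girth-regular graph of girth $2d+1$ for some integer $d$ and signature $(a_1,a_2,a_3)$ with $a_3=2^d$. Then $\Gamma$ is isomorphic to $K_4$ or to the Petersen graph.
   Context: Graphs are finite and simple. For a graph $\Gamma$ of finite girth $g$, a girth cycle is a cycle of length $g$, and for an edge $e$, $\epsilon(e)$ denotes the number of girth cycles containing $e$. If $v$ is a vertex with incident edges $e_1,\ldots,e_k$ ordered so that $\epsilon(e_1)\le\cdots\le\epsilon(e_k)$, the signature of $v$ is $(\epsilon(e_1),\ldots,\epsilon(e_k))$. A graph is girth-regular if all its vertices have the same signature, called the signature of the graph. -}

module Defs where

open import Data.Bool using (Bool; true; false; _∧_; _∨_; not; T)
open import Data.Nat using (ℕ; zero; suc; _+_; _*_; _<_; _≤_; _≤ᵇ_; _≡ᵇ_; _%_)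
open import Data.Fin using (Fin; toℕ)
  renaming (zero to fz; suc to fs)
import Data.Fin as Fin
open import Data.List using (List; []; _∷_; [_]; _++_; length; map; filterᵇ; concatMap; allFin)
open import Data.Bool.ListAction using (any)
open import Data.Product using (Σ; _×_; _,_)
open import Relation.Binary.PropositionalEquality using (_≡_; refl)
open import Relation.Nullary.Decidable using (⌊_⌋)
open import Function.Bundles using (_↔_; Inverse)
open import Data.Bool.Properties using (∨-comm)

record Graph (n : ℕ) : Set where
  field
    adj    : Fin n → Fin n → Bool
    sym    : ∀ x y → adj x y ≡ adj y x
    irrefl : ∀ x → adj x x ≡ false
open Graph public

module _ {n : ℕ} (Γ : Graph n) where

  neighbours : Fin n → List (Fin n)
  neighbours v = filterᵇ (adj Γ v) (allFin n)

  degree : Fin n → ℕ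
  degree v = length (neighbours v)

  allDistinct : List (Fin n) → Bool
  allDistinct []       = true
  allDistinct (x ∷ xs) = not (any (λ y → ⌊ x Fin.≟ y ⌋) xs) ∧ allDistinct xs

  consecAdj : List (Fin n) → Bool
  consecAdj []           = true
  consecAdj (x ∷ [])     = true
  consecAdj (x ∷ y ∷ xs) = adj Γ x y ∧ consecAdj (y ∷ xs)

  closedAdj : List (Fin n) → Bool
  closedAdj []       = true
  closedAdj (x ∷ xs) = consecAdj (x ∷ xs ++ [ x ])

  isCycle : List (Fin n) → Bool
  isCycle c = (3 ≤ᵇ length c) ∧ (allDistinct c ∧ closedAdj c)

  HasCycleOfLength : ℕ → Set
  HasCycleOfLength k = Σ (List (Fin n)) λ c → length c ≡ k × T (isCycle c)

  HasGirth : ℕ → Set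
  HasGirth g = HasCycleOfLength g × (∀ k → k < g → HasCycleOfLength k → Data.Empty.⊥)
    where import Data.Empty

  data Reach : Fin n → Fin n → Set where
    here : ∀ {x} → Reach x x
    step : ∀ {x y z} → T (adj Γ x y) → Reach y z → Reach x z

  Connected : Set
  Connected = ∀ x y → Reach x y

allLists : (n k : ℕ) → List (List (Fin n))
allLists n zero    = [ [] ]
allLists n (suc k) = concatMap (λ x → map (x ∷_) (allLists n k)) (allFin n)

module _ {n : ℕ} (Γ : Graph n) where

  startsWith : Fin n → Fin n → List (Fin n) → Bool
  startsWith u v (x ∷ y ∷ _) = ⌊ x Fin.≟ u ⌋ ∧ ⌊ y Fin.≟ v ⌋
  startsWith u v _           = false

  -- ε(uv): number of cycles of length g containing the edge uv.
  -- Each such cycle is counted exactly once, via its unique vertex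
  -- sequence starting u, v, … (length g ≥ 3).
  ε : (g : ℕ) → Fin n → Fin n → ℕ
  ε g u v = length (filterᵇ (λ c → isCycle Γ c ∧ startsWith u v c) (allLists n g))

  edgeCounts : ℕ → Fin n → List ℕ
  edgeCounts g v = map (ε g v) (neighbours Γ v)

_≅_ : ∀ {n m} → Graph n → Graph m → Set
_≅_ {n} {m} Γ Δ = Σ (Fin n ↔ Fin m) λ f →
  ∀ x y → adj Δ (Inverse.to f x) (Inverse.to f y) ≡ adj Γ x y

K4 : Graph 4
K4 = record
  { adj    = λ x y → not ⌊ x Fin.≟ y ⌋
  ; sym    = s
  ; irrefl = i
  }
  where
  open import Relation.Nullary using (yes; no)
  open import Relation.Binary.PropositionalEquality using () renaming (sym to ≡sym)
  s : ∀ (x y : Fin 4) → not ⌊ x Fin.≟ y ⌋ ≡ not ⌊ y Fin.≟ x ⌋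
  s x y with x Fin.≟ y | y Fin.≟ x
  ... | yes _ | yes _ = refl
  ... | no _  | no _  = refl
  ... | yes p | no q  with q (≡sym p)
  ... | ()
  s x y | no p | yes q with p (≡sym q)
  ... | ()
  i : ∀ (x : Fin 4) → not ⌊ x Fin.≟ x ⌋ ≡ false
  i x with x Fin.≟ x
  ... | yes _ = refl
  ... | no p with p refl
  ... | ()

-- The Petersen graph: outer 5-cycle 0-1-2-3-4-0, inner pentagram on
-- 5..9 (5+i ~ 5+(i+2 mod 5)), spokes i ~ 5+i.

petersenArc : ℕ → ℕ → Bool
petersenArc x y =
     ((x Data.Nat.<ᵇ 5) ∧ (y Data.Nat.<ᵇ 5) ∧ (y ≡ᵇ ((x + 1) % 5)))
  ∨ ((5 ≤ᵇ x) ∧ (5 ≤ᵇ y) ∧ (y ≡ᵇ 5 + ((x + 2) % 5)))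
  ∨ ((x Data.Nat.<ᵇ 5) ∧ (y ≡ᵇ x + 5))
  where import Data.Nat

Petersen : Graph 10
Petersen = record
  { adj    = λ x y → petersenArc (toℕ x) (toℕ y) ∨ petersenArc (toℕ y) (toℕ x)
  ; sym    = λ x y → ∨-comm (petersenArc (toℕ x) (toℕ y)) (petersenArc (toℕ y) (toℕ x))
  ; irrefl = i
  }
  where
  i : ∀ (x : Fin 10) → (petersenArc (toℕ x) (toℕ x) ∨ petersenArc (toℕ x) (toℕ x)) ≡ false
  i fz = refl
  i (fs fz) = refl
  i (fs (fs fz)) = refl
  i (fs (fs (fs fz))) = refl
  i (fs (fs (fs (fs fz)))) = refl
  i (fs (fs (fs (fs (fs fz))))) = refl
  i (fs (fs (fs (fs (fs (fs fz)))))) = refl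
  i (fs (fs (fs (fs (fs (fs (fs fz))))))) = refl
  i (fs (fs (fs (fs (fs (fs (fs (fs fz)))))))) = refl
  i (fs (fs (fs (fs (fs (fs (fs (fs (fs fz))))))))) = refl

{-# OPTIONS --safe #-}

-- Let u v be an edge in 2 ^ d girth cycles. Since the girth is 2 d + 1, a girth cycle through u v is
-- determined by its half of length d starting in v, and there are only 2 ^ d such halves; so every
-- nonbacktracking walk of length d from v avoiding u ends where such a walk from u avoiding v ends, and
-- conversely. As every vertex lies on such an edge, the ball of radius d around a vertex is closed under
-- adjacency, hence the graph is a cubic Moore graph of diameter d. For d = 1 and d = 2 it is K4 and the
-- Petersen graph.
--
-- For d ≥ 3 there is no cubic Moore graph. The numbers N k of nonbacktracking walks of length k satisfy
-- A N k = N (k + 1) + 2 N (k - 1), and the adjacency matrix A has an eigenvalue u = -3 + 2 ^ d + … in the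
-- 2-adic integers. Modulo a power of two, the corresponding combination of the matrices N k is a multiple
-- of an idempotent, so its trace gives the multiplicity of u as an integer between 0 and n + 1; it has to
-- be 1 + t 2 ^ (d - 1) with t < 6, and the next 2-adic digits force 2 ^ (d - 1) to divide 3 t + 12 d + 50.
-- This fails for d ≥ 3, except that for d = 3, 4, 6 more digits of u are needed.
module Submission where

open import Defs renaming (sym to adj-sym; irrefl to adj-irrefl)
open import Data.Empty using (⊥; ⊥-elim)
open import Data.Fin using (Fin)
open import Data.List using (List; []; _∷_)
open import Data.List.Relation.Binary.Permutation.Propositional using (_↭_; ↭-sym)
open import Data.Product using (∃; _×_; _,_; proj₁; proj₂)
open import Data.Sum using (_⊎_; inj₁; inj₂; [_,_]′)
open import Data.Unit using (⊤; tt)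
open import Function using (_∘_; Equivalence; mk↔ₛ′)
open import Relation.Binary.PropositionalEquality
  using (_≡_; _≢_; refl; cong; cong₂; subst; trans; sym; ≢-sym; module ≡-Reasoning)
open import Relation.Nullary using (¬_; Dec; yes; no; contradiction)
open import Relation.Nullary.Decidable using (⌊_⌋; ¬?; decidable-stable; toWitness)
import Data.Nat.Properties as ℕ

-- Nonbacktracking walks and the Moore property

-- In the graph part the difficulty is one of position: the edge at the centre of a ball that lies
-- in `2 ^ d` girth cycles need not lie on the walk that has to be shortened. `closed` therefore
-- combines such an edge at the centre with one at the far end of the walk, and `shortcut` treats
-- the case where that edge comes second on the walk.
--
-- In the spectral part neither an eigenvector nor an exact eigenvalue is constructed. It is enough
-- that `u` is a root modulo a power of two. The multiplicity is the number of rank-one matrices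
-- that elimination splits off from a matrix `H` with `H H ≡ T H`, each of them taking `T` out of
-- the trace. What remains has even entries and must vanish, but that argument needs a unit in the
-- place of `T`, whereas `T` is twice an odd number. The way out is that `H` is the all-ones matrix
-- modulo 2: one elimination makes every entry even, and halving the matrix also halves the scalar.
--
-- The value -3 is chosen because the coefficient recursion there has the roots -1 and -2, so that
-- everything has a closed form.

module _ where

  open import Data.Bool using (T; _∧_; not)
  open import Data.Bool.ListAction using (any)
  open import Data.Bool.Properties using (T-∧; T?)
  open import Data.Nat as ℕ using (ℕ; zero; suc; _+_; _*_; _^_; _≤_; _<_; z≤n; s≤s)
  open import Data.Fin using (_≟_)
  open import Data.List using (_++_; _ʳ++_; [_]; length; map; reverse; allFin; take; drop; filterᵇ; cartesianProductWith; concatMap)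
  import Data.List.Properties as List
  open import Data.List.Membership.Propositional using (_∈_; _∉_)
  import Data.List.Membership.DecPropositional as DecMembership
  import Data.List.Membership.Propositional.Properties as ∈
  open import Data.List.Relation.Binary.Subset.Propositional using (_⊆_)
  open import Data.List.Relation.Unary.All using (All; []; _∷_)
  import Data.List.Relation.Unary.All as All
  import Data.List.Relation.Unary.All.Properties as All
  open import Data.List.Relation.Unary.AllPairs using ([]; _∷_)
  open import Data.List.Relation.Unary.Any using (here; there)
  import Data.List.Relation.Unary.Any.Properties as Any
  open import Data.List.Relation.Unary.Unique.Propositional using (Unique)
  import Data.List.Relation.Unary.Unique.Propositional.Properties as Unique
  open import Relation.Binary.Definitions using (DecidableEquality)

  lastOf : ∀ {A : Set} → A → List A → A
  lastOf x []      = x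
  lastOf x (y ∷ l) = lastOf y l

  lastOf-∈ : ∀ {A : Set} (x : A) l → lastOf x l ∈ x ∷ l
  lastOf-∈ x []      = here refl
  lastOf-∈ x (y ∷ l) = there (lastOf-∈ y l)

  lastOf-∷ʳ : ∀ {A : Set} (x : A) l y → lastOf x (l ++ y ∷ []) ≡ y
  lastOf-∷ʳ x []      y = refl
  lastOf-∷ʳ x (z ∷ l) y = lastOf-∷ʳ z l y

  -- Exposes the head of a reversed walk, since facts about walks are stated for a list `x ∷ l`.
  ʳ++-∷ : ∀ {A : Set} (x : A) p q → ∃ λ m → (p ʳ++ (x ∷ q)) ≡ lastOf x p ∷ m
          × length m ≡ length p + length q × lastOf (lastOf x p) m ≡ lastOf x q
  ʳ++-∷ x []      q = q , refl , refl , refl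
  ʳ++-∷ x (a ∷ p) q with ʳ++-∷ a p (x ∷ q)
  ... | m , eq , len , last = m , eq , trans len (ℕ.+-suc (length p) (length q)) , last

  Unique-prefix : ∀ {A : Set} {x : A} ys zs → Unique (ys ++ x ∷ zs) → Unique (x ∷ ys)
  Unique-prefix []       zs u        = [] ∷ []
  Unique-prefix (y ∷ ys) zs (y∉ ∷ u) with Unique-prefix ys zs u
  ... | x∉ ∷ uys = (≢-sym (All.head (All.++⁻ʳ ys y∉)) ∷ x∉) ∷ (All.++⁻ˡ ys y∉ ∷ uys)

  Unique-∉ : ∀ {A : Set} {x : A} {l} → Unique (x ∷ l) → x ∉ l
  Unique-∉ (x∉ ∷ _) x∈ = All.lookup x∉ x∈ refl

  -- Nonbacktracking walks and the girth

  module Walks {n : ℕ} (Γ : Graph n) where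

    V : Set
    V = Fin n

    infix 4 _~_
    _~_ : V → V → Set
    x ~ y = T (adj Γ x y)

    ~-sym : ∀ {x y} → x ~ y → y ~ x
    ~-sym {x} {y} = subst T (adj-sym Γ x y)

    ~⇒≢ : ∀ {x y} → x ~ y → x ≢ y
    ~⇒≢ {x} x~x refl = subst T (adj-irrefl Γ x) x~x

    -- Vacuous at the end of a walk, so that one constructor of `NB` also covers the last step.
    Off : V → List V → Set
    Off x []      = ⊤
    Off x (y ∷ l) = x ≢ y

    -- Vertex sequences of nonbacktracking walks.
    data NB : List V → Set where
      [-]  : ∀ {x} → NB (x ∷ [])
      cons : ∀ {x y l} → x ~ y → Off x l → NB (y ∷ l) → NB (x ∷ y ∷ l)

    NB-tail : ∀ {x y l} → NB (x ∷ y ∷ l) → NB (y ∷ l)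
    NB-tail (cons _ _ nb) = nb

    NB-head : ∀ {x y l} → NB (x ∷ y ∷ l) → x ~ y
    NB-head (cons x~y _ _) = x~y

    NB-off : ∀ {x y l} → NB (x ∷ y ∷ l) → Off x l
    NB-off (cons _ off _) = off

    Off-++ : ∀ {x} l {m} → Off x (l ++ m) → Off x l
    Off-++ []      _   = tt
    Off-++ (y ∷ l) off = off

    NB-++ : ∀ {x} l m → NB (x ∷ l ++ m) → NB (x ∷ l)
    NB-++ []      m nb               = [-]
    NB-++ (y ∷ l) m (cons e off nb) = cons e (Off-++ l off) (NB-++ l m nb)

    Apart : List V → List V → Set
    Apart []      q = ⊤
    Apart (a ∷ _) q = Off a q

    -- Going back along the first walk and on along the second can turn back only at the common
    -- start `x`; `Apart` excludes this.
    NB-ʳ++ : ∀ {x} p {q} → NB (x ∷ p) → NB (x ∷ q) → Apart p q → NB (p ʳ++ (x ∷ q))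
    NB-ʳ++ []           nbp             nbq _   = nbq
    NB-ʳ++ (a ∷ [])     (cons e off _)  nbq off′ = cons (~-sym e) off′ nbq
    NB-ʳ++ (a ∷ b ∷ p)  (cons e off nb) nbq off′ =
      NB-ʳ++ (b ∷ p) nb (cons (~-sym e) off′ nbq) (≢-sym off)

    Unique⇒allDistinct : ∀ {l} → Unique l → T (allDistinct Γ l)
    Unique⇒allDistinct []              = tt
    Unique⇒allDistinct {x ∷ l} (x∉ ∷ u) = Equivalence.from T-∧ (notAny l x∉ , Unique⇒allDistinct u)
      where
      notAny : ∀ l → All (x ≢_) l → T (not (any (λ y → ⌊ x ≟ y ⌋) l))
      notAny []      []       = tt
      notAny (y ∷ l) (x≢y ∷ x∉) with x ≟ y
      ... | yes x≡y = contradiction x≡y x≢y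
      ... | no  _   = notAny l x∉

    allDistinct⇒Unique : ∀ l → T (allDistinct Γ l) → Unique l
    allDistinct⇒Unique []      _ = []
    allDistinct⇒Unique (x ∷ l) t with Equivalence.to T-∧ t
    ... | notAny , t′ = all l notAny ∷ allDistinct⇒Unique l t′
      where
      all : ∀ l → T (not (any (λ y → ⌊ x ≟ y ⌋) l)) → All (x ≢_) l
      all []      _ = []
      all (y ∷ l) t with x ≟ y
      ... | no x≢y = x≢y ∷ all l t

    NB⇒consecAdj : ∀ {x} ys {y} zs → NB (x ∷ ys ++ y ∷ zs) → T (consecAdj Γ (x ∷ ys ++ [ y ]))
    NB⇒consecAdj []       zs (cons e _ _)  = Equivalence.from T-∧ (e , tt)
    NB⇒consecAdj (_ ∷ ys) zs (cons e _ nb) = Equivalence.from T-∧ (e , NB⇒consecAdj ys zs nb)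

    NB-cycle : ∀ {x} ys zs → NB (x ∷ ys ++ x ∷ zs) → Unique (x ∷ ys) → T (isCycle Γ (x ∷ ys))
    NB-cycle []           zs (cons e _ _)  u = contradiction refl (~⇒≢ e)
    NB-cycle (y ∷ [])     zs (cons _ off _) u = contradiction refl off
    NB-cycle (y ∷ z ∷ ys) zs nb u =
      Equivalence.from T-∧ (tt , Equivalence.from T-∧ (Unique⇒allDistinct u , NB⇒consecAdj (y ∷ z ∷ ys) zs nb))

    module Girth (g : ℕ) (acyclic : ∀ k → k < g → HasCycleOfLength Γ k → ⊥) where

      -- By induction the tail has no repetition. If it contained the first vertex, the segment up
      -- to there would close to a cycle of length less than `g`.
      NB⇒Unique : ∀ {l} → NB l → length l ≤ g → Unique l
      NB⇒Unique [-] _ = [] ∷ []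
      NB⇒Unique {x ∷ l@(_ ∷ _)} nb@(cons _ _ nb′) len =
        All.¬Any⇒All¬ l x∉ ∷ u
        where
        u : Unique l
        u = NB⇒Unique nb′ (ℕ.≤-trans (ℕ.n≤1+n _) len)
        x∉ : x ∉ l
        x∉ x∈ with ∈.∈-∃++ x∈
        ... | ys , zs , eq = acyclic (suc (length ys)) short
          (x ∷ ys , refl , NB-cycle ys zs (subst (NB ∘ (x ∷_)) eq nb) (Unique-prefix ys zs (subst Unique eq u)))
          where
          short : suc (length ys) < g
          short = ℕ.≤-trans (s≤s (ℕ.≤-trans (ℕ.m≤m+n _ (length zs))
            (ℕ.≤-reflexive (trans (sym (ℕ.+-suc _ _)) (trans (sym (List.length-++ ys)) (cong length (sym eq))))))) len

      NB-open : ∀ {x y l} → NB (x ∷ y ∷ l) → 2 + length l ≤ g → lastOf y l ≢ x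
      NB-open nb len refl = Unique-∉ (NB⇒Unique nb len) (lastOf-∈ _ _)

      -- Once the common initial part is stripped, one walk reversed and continued by the other is
      -- nonbacktracking, closed, and has fewer than `g` edges; `NB-open` excludes it.
      NB-unique : ∀ {x} p q → NB (x ∷ p) → NB (x ∷ q) → lastOf x p ≡ lastOf x q →
                  length p + length q < g → p ≡ q
      NB-unique []      []      _   _   _  _   = refl
      NB-unique []      (b ∷ q) _   nbq eq len = contradiction (sym eq) (NB-open nbq len)
      NB-unique (a ∷ p) []      nbp _   eq len =
        contradiction eq (NB-open nbp (subst (_< g) (ℕ.+-identityʳ _) len))
      NB-unique {x} (a ∷ p) (b ∷ q) nbp nbq eq len with a ≟ b
      ... | yes refl = cong (a ∷_) (NB-unique p q (NB-tail nbp) (NB-tail nbq) eq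
        (ℕ.≤-trans (s≤s (ℕ.≤-trans (ℕ.+-monoʳ-≤ (length p) (ℕ.n≤1+n _)) (ℕ.n≤1+n _))) len))
      ... | no a≢b with ʳ++-∷ a p (x ∷ b ∷ q) | NB-ʳ++ (a ∷ p) nbp nbq a≢b
      ...   | m , meq , mlen , mlast | nb = closed m (subst NB meq nb) mlen mlast
        where
        closed : ∀ m → NB (lastOf a p ∷ m) → length m ≡ length p + (2 + length q) →
                 lastOf (lastOf a p) m ≡ lastOf b q → a ∷ p ≡ b ∷ q
        closed []      _  l0 _  with () ← trans l0 (ℕ.+-suc _ _)
        closed (c ∷ m) nb l0 l1 = contradiction (trans l1 (sym eq)) (NB-open nb
          (subst (_≤ g) (cong suc (trans (sym (ℕ.+-suc (length p) (suc (length q)))) (sym l0))) len))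

  Unique⊆⇒length≤ : ∀ {A : Set} {xs ys : List A} → Unique xs → xs ⊆ ys → length xs ≤ length ys
  Unique⊆⇒length≤ {xs = []}     _        _   = z≤n
  Unique⊆⇒length≤ {xs = x ∷ xs} (x∉ ∷ u) sub with ∈.∈-∃++ (sub (here refl))
  ... | ps , qs , refl = ℕ.≤-trans (s≤s (Unique⊆⇒length≤ u sub′)) (ℕ.≤-reflexive len)
    where
    sub′ : xs ⊆ ps ++ qs
    sub′ y∈ with ∈.∈-++⁻ ps (sub (there y∈))
    ... | inj₁ y∈ps         = ∈.∈-++⁺ˡ y∈ps
    ... | inj₂ (here refl)  = contradiction refl (All.lookup x∉ y∈)
    ... | inj₂ (there y∈qs) = ∈.∈-++⁺ʳ ps y∈qs
    len : suc (length (ps ++ qs)) ≡ length (ps ++ x ∷ qs)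
    len = trans (cong suc (List.length-++ ps)) (trans (sym (ℕ.+-suc _ _)) (sym (List.length-++ ps)))

  Unique⊆⇒⊇ : ∀ {A : Set} → DecidableEquality A → {xs ys : List A} →
              Unique xs → xs ⊆ ys → length ys ≤ length xs → ys ⊆ xs
  Unique⊆⇒⊇ _≟_ {xs} {ys} u sub len {y} y∈ with DecMembership._∈?_ _≟_ y xs
  ... | yes y∈xs = y∈xs
  ... | no  y∉xs = contradiction (Unique⊆⇒length≤ {xs = y ∷ xs} (All.¬Any⇒All¬ xs y∉xs ∷ u) sub′) (ℕ.<⇒≱ (s≤s len))
    where
    sub′ : y ∷ xs ⊆ ys
    sub′ (here refl) = y∈
    sub′ (there z∈)  = sub z∈

  module Cubic {n : ℕ} (Γ : Graph n) (cubic : ∀ v → degree Γ v ≡ 3) where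

    open Walks Γ public

    ∈-neighbours⁺ : ∀ {v w} → v ~ w → w ∈ neighbours Γ v
    ∈-neighbours⁺ {v} {w} = ∈.∈-filter⁺ (T? ∘ adj Γ v) (∈.∈-allFin w)

    ∈-neighbours⁻ : ∀ {v w} → w ∈ neighbours Γ v → v ~ w
    ∈-neighbours⁻ {v} w∈ = proj₂ (∈.∈-filter⁻ (T? ∘ adj Γ v) {xs = allFin n} w∈)

    record Others (p v : V) : Set where
      field
        {a b} : V
        v~a   : v ~ a
        v~b   : v ~ b
        p≢a   : p ≢ a
        p≢b   : p ≢ b
        a≢b   : a ≢ b
        only  : ∀ {w} → v ~ w → w ≡ p ⊎ w ≡ a ⊎ w ≡ b

    others : ∀ {p v} → v ~ p → Others p v
    others {p} {v} v~p with neighbours Γ v in eq | cubic v | Unique.filter⁺ (T? ∘ adj Γ v) (Unique.allFin⁺ n)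
    ... | l@(x ∷ y ∷ z ∷ []) | refl | u =
          pick u (subst (p ∈_) eq (∈-neighbours⁺ v~p))
      where
      to : ∀ {w} → w ∈ l → v ~ w
      to = ∈-neighbours⁻ ∘ subst (_ ∈_) (sym eq)
      from : ∀ {w} → v ~ w → w ≡ x ⊎ w ≡ y ⊎ w ≡ z
      from e with subst (_ ∈_) eq (∈-neighbours⁺ e)
      ... | here w≡x                 = inj₁ w≡x
      ... | there (here w≡y)         = inj₂ (inj₁ w≡y)
      ... | there (there (here w≡z)) = inj₂ (inj₂ w≡z)
      pick : Unique l → p ∈ l → Others p v
      pick ((x≢y ∷ x≢z ∷ []) ∷ (y≢z ∷ []) ∷ _) (here refl) = record
        { v~a = to (there (here refl)) ; v~b = to (there (there (here refl)))
        ; p≢a = x≢y ; p≢b = x≢z ; a≢b = y≢z ; only = from }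
      pick ((x≢y ∷ x≢z ∷ []) ∷ (y≢z ∷ []) ∷ _) (there (here refl)) = record
        { v~a = to (here refl) ; v~b = to (there (there (here refl)))
        ; p≢a = ≢-sym x≢y ; p≢b = y≢z ; a≢b = x≢z
        ; only = λ e → case (from e) }
        where
        case : ∀ {w} → w ≡ x ⊎ w ≡ y ⊎ w ≡ z → w ≡ y ⊎ w ≡ x ⊎ w ≡ z
        case (inj₁ q)        = inj₂ (inj₁ q)
        case (inj₂ (inj₁ q)) = inj₁ q
        case (inj₂ (inj₂ q)) = inj₂ (inj₂ q)
      pick ((x≢y ∷ x≢z ∷ []) ∷ (y≢z ∷ []) ∷ _) (there (there (here refl))) = record
        { v~a = to (here refl) ; v~b = to (there (here refl))
        ; p≢a = ≢-sym x≢z ; p≢b = ≢-sym y≢z ; a≢b = x≢y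
        ; only = λ e → case (from e) }
        where
        case : ∀ {w} → w ≡ x ⊎ w ≡ y ⊎ w ≡ z → w ≡ z ⊎ w ≡ x ⊎ w ≡ y
        case (inj₁ q)        = inj₂ (inj₁ q)
        case (inj₂ (inj₁ q)) = inj₂ (inj₂ q)
        case (inj₂ (inj₂ q)) = inj₁ q

    -- The continuations of a nonbacktracking walk that arrives at `v` from `p`, with a binary
    -- choice at each step.
    extensions : ∀ (k : ℕ) {p v} → v ~ p → List (List V)
    extensions zero    _ = [ [] ]
    extensions (suc k) e = map (a ∷_) (extensions k (~-sym v~a)) ++ map (b ∷_) (extensions k (~-sym v~b))
      where open Others (others e)

    length-extensions : ∀ (k : ℕ) {p v} (e : v ~ p) → length (extensions k e) ≡ 2 ^ k
    length-extensions zero    _ = refl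
    length-extensions (suc k) e = begin
      length (map (a ∷_) as ++ map (b ∷_) bs)          ≡⟨ List.length-++ (map (a ∷_) as) ⟩
      length (map (a ∷_) as) + length (map (b ∷_) bs)  ≡⟨ cong₂ _+_ (List.length-map (a ∷_) as) (List.length-map (b ∷_) bs) ⟩
      length as + length bs                            ≡⟨ cong₂ _+_ (length-extensions k _) (length-extensions k _) ⟩
      2 ^ k + 2 ^ k                                    ≡⟨ cong (2 ^ k +_) (ℕ.+-identityʳ _) ⟨
      2 ^ suc k                                        ∎
      where
      open Others (others e)
      open ≡-Reasoning
      as = extensions k (~-sym v~a)
      bs = extensions k (~-sym v~b)

    ∈-extensions : ∀ {p v} (e : v ~ p) l → NB (p ∷ v ∷ l) → l ∈ extensions (length l) e
    ∈-extensions e []      _ = here refl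
    ∈-extensions e (w ∷ l) (cons _ p≢w nb) with Others.only (others e) (NB-head nb)
    ... | inj₁ w≡p         = contradiction (sym w≡p) p≢w
    ... | inj₂ (inj₁ refl) = ∈.∈-++⁺ˡ (∈.∈-map⁺ (w ∷_) (∈-extensions _ l nb))
    ... | inj₂ (inj₂ refl) = ∈.∈-++⁺ʳ (map (Others.a (others e) ∷_) _) (∈.∈-map⁺ (w ∷_) (∈-extensions _ l nb))

  Unique-map∈ : ∀ {A B : Set} (f : A → B) {l : List A} →
                (∀ {x y} → x ∈ l → y ∈ l → f x ≡ f y → x ≡ y) → Unique l → Unique (map f l)
  Unique-map∈ f {[]}    inj []       = []
  Unique-map∈ f {x ∷ l} inj (x∉ ∷ u) =
    All.map⁺ (All.tabulate λ y∈ eq → All.lookup x∉ y∈ (inj (here refl) (there y∈) eq))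
    ∷ Unique-map∈ f (λ x∈ y∈ → inj (there x∈) (there y∈)) u

  concatMap≡cartesianProductWith : ∀ {A B C : Set} (f : A → B → C) xs ys →
    concatMap (λ x → map (f x) ys) xs ≡ cartesianProductWith f xs ys
  concatMap≡cartesianProductWith f []       ys = refl
  concatMap≡cartesianProductWith f (x ∷ xs) ys = cong (map (f x) ys ++_) (concatMap≡cartesianProductWith f xs ys)

  allLists-Unique : ∀ n k → Unique (allLists n k)
  allLists-Unique n zero    = [] ∷ []
  allLists-Unique n (suc k) = subst Unique (sym (concatMap≡cartesianProductWith _∷_ (allFin n) (allLists n k)))
    (Unique.cartesianProductWith⁺ _∷_ List.∷-injective (Unique.allFin⁺ n) (allLists-Unique n k))

  ∈-allLists⁻ : ∀ n k {l} → l ∈ allLists n k → length l ≡ k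
  ∈-allLists⁻ n zero    (here refl) = refl
  ∈-allLists⁻ n (suc k) l∈ with ∈.∈-cartesianProductWith⁻ _∷_ (allFin n) (allLists n k)
    (subst (_ ∈_) (concatMap≡cartesianProductWith _∷_ (allFin n) (allLists n k)) l∈)
  ... | _ , _ , _ , b∈ , refl = cong suc (∈-allLists⁻ n k b∈)

  take-length-∷ : ∀ {A : Set} (y : List A) w z → take (suc (length y)) (y ++ w ∷ z) ≡ y ++ [ w ]
  take-length-∷ []      w z = refl
  take-length-∷ (a ∷ y) w z = cong (a ∷_) (take-length-∷ y w z)

  take-length-++ : ∀ {A : Set} (y z : List A) → take (length y) (y ++ z) ≡ y
  take-length-++ []      z = refl
  take-length-++ (a ∷ y) z = cong (a ∷_) (take-length-++ y z)

  split-middle : ∀ {A : Set} e k (l : List A) → length l ≡ e + suc k →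
                 ∃ λ y → ∃ λ w → ∃ λ z → l ≡ y ++ w ∷ z × length y ≡ e × length z ≡ k
  split-middle zero    k (w ∷ z) refl = [] , w , z , refl , refl , refl
  split-middle (suc e) k (a ∷ l) len with split-middle e k l (ℕ.suc-injective len)
  ... | y , w , z , refl , refl , refl = a ∷ y , w , z , refl , refl , refl

  -- Girth cycles through an edge and their two halves

  module Cycles {n : ℕ} (Γ : Graph n) (cubic : ∀ v → degree Γ v ≡ 3) (e : ℕ)
    (acyclic : ∀ k → k < 2 * suc e + 1 → HasCycleOfLength Γ k → ⊥) where

    open Cubic Γ cubic public

    d g : ℕ
    d = suc e
    g = 2 * d + 1

    open Girth g acyclic public

    d+d<g : d + d < g
    d+d<g = ℕ.≤-reflexive (trans (cong (suc ∘ (d +_)) (sym (ℕ.+-identityʳ d))) (ℕ.+-comm 1 (2 * d)))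

    NB-suffix : ∀ y {w z} → NB (y ++ w ∷ z) → NB (w ∷ z)
    NB-suffix []          nb            = nb
    NB-suffix (a ∷ [])    (cons _ _ nb) = nb
    NB-suffix (a ∷ b ∷ y) (cons _ _ nb) = NB-suffix (b ∷ y) nb

    NB-reverse : ∀ {x l} → NB (x ∷ l) → NB (reverse (x ∷ l))
    NB-reverse {l = l} nb = NB-ʳ++ l nb [-] (apart l)
      where
      apart : ∀ l → Apart l []
      apart []      = tt
      apart (_ ∷ _) = tt

    consecAdj⇒NB : ∀ {u x} m → Unique (x ∷ m) → u ∉ x ∷ m →
                   T (consecAdj Γ (x ∷ m ++ [ u ])) → NB (x ∷ m ++ [ u ])
    consecAdj⇒NB []          _ _ t = cons (proj₁ (Equivalence.to T-∧ t)) tt [-]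
    consecAdj⇒NB (y ∷ [])    (_ ∷ uq) u∉ t with Equivalence.to T-∧ t
    ... | x~y , t′ = cons x~y (λ x≡u → u∉ (here (sym x≡u))) (consecAdj⇒NB [] uq (u∉ ∘ there) t′)
    consecAdj⇒NB (y ∷ z ∷ m) ((_ ∷ x≢z ∷ _) ∷ uq) u∉ t with Equivalence.to T-∧ t
    ... | x~y , t′ = cons x~y x≢z (consecAdj⇒NB (z ∷ m) uq (u∉ ∘ there) t′)

    cycle⇒NB : ∀ {u v w} l → Unique (u ∷ v ∷ w ∷ l) → T (closedAdj Γ (u ∷ v ∷ w ∷ l)) →
               NB (u ∷ v ∷ w ∷ l ++ [ u ])
    cycle⇒NB {w = w} l uq@((_ ∷ u≢w ∷ _) ∷ uq′) t with Equivalence.to T-∧ t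
    ... | u~v , t′ = cons u~v u≢w (consecAdj⇒NB (w ∷ l) uq′ (Unique-∉ uq) t′)

    cycles : V → V → List (List V)
    cycles u v = filterᵇ (λ c → isCycle Γ c ∧ startsWith Γ u v c) (allLists n g)

    ∉⇒Off : ∀ {x} l → x ∉ l → Off x l
    ∉⇒Off []      _  = tt
    ∉⇒Off (y ∷ l) x∉ = x∉ ∘ here

    -- Beyond `u` and `v` a girth cycle has `2 d - 1` vertices, so the arcs of `d` vertices from
    -- either side overlap exactly in the middle one, and both end there.
    arcᵛ arcᵘ : List V → List V
    arcᵛ c = take d (drop 2 c)
    arcᵘ c = take d (reverse (drop 2 c))

    record Arcs (u v : V) (c : List V) : Set where
      field
        u~v    : u ~ v
        nbᵛ    : NB (u ∷ v ∷ arcᵛ c)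
        nbᵘ    : NB (v ∷ u ∷ arcᵘ c)
        lenᵛ   : length (arcᵛ c) ≡ d
        lenᵘ   : length (arcᵘ c) ≡ d
        meet   : lastOf v (arcᵛ c) ≡ lastOf u (arcᵘ c)
        -- `take e` drops the middle vertex, which the other arc already supplies.
        joined : c ≡ u ∷ v ∷ take e (arcᵛ c) ++ reverse (arcᵘ c)

    startsWith⇒ : ∀ {u v} c → T (startsWith Γ u v c) → ∃ λ l → c ≡ u ∷ v ∷ l
    startsWith⇒ {u} {v} (x ∷ y ∷ l) t with x ≟ u | y ≟ v | t
    ... | yes refl | yes refl | _ = l , refl

    arcs-of : ∀ {u v} y w z → length y ≡ e → length z ≡ e → Unique (u ∷ v ∷ y ++ w ∷ z) →
              NB (u ∷ v ∷ (y ++ w ∷ z) ++ [ u ]) → Arcs u v (u ∷ v ∷ y ++ w ∷ z)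
    arcs-of {u} {v} y w z leny lenz (_ ∷ uq) nb = record
      { u~v    = NB-head nb
      ; nbᵛ    = subst (NB ∘ (u ∷_) ∘ (v ∷_)) (sym arcᵛ≡) (NB-++ (v ∷ y ++ [ w ]) (z ++ [ u ]) (subst (NB ∘ (u ∷_) ∘ (v ∷_)) assoc nb))
      ; nbᵘ    = subst (NB ∘ (v ∷_) ∘ (u ∷_)) (sym arcᵘ≡) (cons (~-sym (NB-head nb)) (∉⇒Off (reverse z ++ [ w ]) v∉) (subst NB rev≡ (NB-reverse {w} (NB-suffix (u ∷ v ∷ y) (subst (NB ∘ (u ∷_) ∘ (v ∷_)) (List.++-assoc y (w ∷ z) [ u ]) nb)))))
      ; lenᵛ   = trans (cong length arcᵛ≡) (trans (List.length-++ y) (trans (ℕ.+-comm (length y) 1) (cong suc leny)))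
      ; lenᵘ   = trans (cong length arcᵘ≡) (trans (List.length-++ (reverse z)) (trans (ℕ.+-comm (length (reverse z)) 1) (cong suc (trans (List.length-reverse z) lenz))))
      ; meet   = trans (cong (lastOf v) arcᵛ≡) (trans (lastOf-∷ʳ v y w) (sym (trans (cong (lastOf u) arcᵘ≡) (lastOf-∷ʳ u (reverse z) w))))
      ; joined = cong (λ l → u ∷ v ∷ l) (cong₂ _++_ (sym (trans (cong (take e) arcᵛ≡) (trans (cong (λ k → take k (y ++ [ w ])) (sym leny)) (take-length-++ y [ w ])))) (sym (trans (cong reverse (trans arcᵘ≡ (sym (List.unfold-reverse w z)))) (List.reverse-involutive (w ∷ z)))))
      }
      where
      c = u ∷ v ∷ y ++ w ∷ z
      arcᵛ≡ : arcᵛ c ≡ y ++ [ w ]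
      arcᵛ≡ = trans (cong (λ k → take (suc k) (y ++ w ∷ z)) (sym leny)) (take-length-∷ y w z)
      reverse≡ : reverse (y ++ w ∷ z) ≡ reverse z ++ w ∷ reverse y
      reverse≡ = trans (List.reverse-++ y (w ∷ z)) (trans (cong (_++ reverse y) (List.unfold-reverse w z)) (List.++-assoc (reverse z) [ w ] (reverse y)))
      arcᵘ≡ : arcᵘ c ≡ reverse z ++ [ w ]
      arcᵘ≡ = trans (cong₂ (λ k → take (suc k)) (sym (trans (List.length-reverse z) lenz)) reverse≡) (take-length-∷ (reverse z) w (reverse y))
      assoc : (y ++ w ∷ z) ++ [ u ] ≡ (y ++ [ w ]) ++ z ++ [ u ]
      assoc = trans (List.++-assoc y (w ∷ z) [ u ]) (sym (List.++-assoc y [ w ] (z ++ [ u ])))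
      rev≡ : reverse (w ∷ z ++ [ u ]) ≡ u ∷ reverse z ++ [ w ]
      rev≡ = trans (List.reverse-++ (w ∷ z) [ u ]) (cong (u ∷_) (List.unfold-reverse w z))
      v∉ : v ∉ reverse z ++ [ w ]
      v∉ v∈ = Unique-∉ uq (∈.∈-++⁺ʳ y (Any.reverse⁻ (subst (v ∈_) (sym (List.unfold-reverse w z)) v∈)))
        where import Data.List.Relation.Unary.Any.Properties as Any

    length-rest : ∀ {A : Set} {x y : A} l → length (x ∷ y ∷ l) ≡ g → length l ≡ e + suc e
    length-rest l len = ℕ.suc-injective (ℕ.suc-injective (trans len eq))
      where
      eq : g ≡ 2 + (e + suc e)
      eq = trans (ℕ.+-comm (2 * d) 1) (cong (suc ∘ suc) (trans (cong (λ k → e + suc k) (ℕ.+-identityʳ e)) refl))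

    arcs : ∀ {u v c} → c ∈ cycles u v → Arcs u v c
    arcs {u} {v} {c} c∈ with ∈.∈-filter⁻ (λ c → T? (isCycle Γ c ∧ startsWith Γ u v c)) {xs = allLists n g} c∈
    ... | c∈all , t with Equivalence.to (T-∧ {isCycle Γ c}) t
    ...   | cyc , start with startsWith⇒ c start
    ...     | l , refl with split-middle e e l (length-rest {x = u} {v} l (∈-allLists⁻ n g c∈all))
    ...       | y , w , z , refl , leny , lenz =
      arcs-of y w z leny lenz uq (toNB y z uq (proj₂ (Equivalence.to (T-∧ {allDistinct Γ c}) cyc′)))
      where
      cyc′ = proj₂ (Equivalence.to (T-∧ {3 ℕ.≤ᵇ length c}) cyc)
      uq : Unique c
      uq = allDistinct⇒Unique c (proj₁ (Equivalence.to (T-∧ {allDistinct Γ c}) cyc′))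
      toNB : ∀ {w} y z → Unique (u ∷ v ∷ y ++ w ∷ z) → T (closedAdj Γ (u ∷ v ∷ y ++ w ∷ z)) →
             NB (u ∷ v ∷ (y ++ w ∷ z) ++ [ u ])
      toNB []      z = cycle⇒NB z
      toNB (a ∷ y) z = cycle⇒NB (y ++ _ ∷ z)

    cycles-Unique : ∀ u v → Unique (cycles u v)
    cycles-Unique u v = Unique.filter⁺ _ (allLists-Unique n g)

    -- The end of a walk of length k from v whose first step avoids p.
    Away : V → V → ℕ → V → Set
    Away p v k t = ∃ λ l → length l ≡ k × NB (p ∷ v ∷ l) × lastOf v l ≡ t

    -- All that is kept of the hypothesis on the signature: the arguments about balls never return
    -- to counting cycles.
    record Full (u v : V) : Set where
      field
        edge : u ~ v
        into : ∀ {t} → Away u v d t → Away v u d t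
        back : ∀ {t} → Away v u d t → Away u v d t

    Full-sym : ∀ {u v} → Full u v → Full v u
    Full-sym f = record { edge = ~-sym edge ; into = back ; back = into }
      where open Full f

    same-length : ∀ {A : Set} (p q : List A) → length p ≡ d → length q ≡ d → length p + length q < g
    same-length p q lp lq = subst (_< g) (sym (cong₂ _+_ lp lq)) d+d<g

    -- Two cycles with the same arc on one side have arcs on the other side with the same ends and
    -- total length `2 d < g`, which agree by `NB-unique`. Taking arcs is thus injective, and the
    -- arcs exhaust the `2 ^ d` entries of `extensions`. The opposite arc of the cycle found this
    -- way is the required walk.
    full : ∀ {u v} → u ~ v → 2 ^ d ≤ ε Γ g u v → Full u v
    full {u} {v} u~v many = record { edge = u~v ; into = to ; back = from }
      where
      _≟ₗ_ : DecidableEquality (List V)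
      _≟ₗ_ = List.≡-dec _≟_
      onto : ∀ {p q} (e : q ~ p) (f : List V → List V) →
             (∀ {c} → c ∈ cycles u v → length (f c) ≡ d × NB (p ∷ q ∷ f c)) →
             (∀ {c c′} → c ∈ cycles u v → c′ ∈ cycles u v → f c ≡ f c′ → c ≡ c′) →
             ∀ l → length l ≡ d → NB (p ∷ q ∷ l) → ∃ λ c → c ∈ cycles u v × l ≡ f c
      onto e f sound inj l len nb = ∈.∈-map⁻ f (Unique⊆⇒⊇ _≟ₗ_
        (Unique-map∈ f inj (cycles-Unique u v)) sub
        (ℕ.≤-trans (ℕ.≤-reflexive (length-extensions d e)) (ℕ.≤-trans many (ℕ.≤-reflexive (sym (List.length-map f (cycles u v))))))
        (subst (λ k → l ∈ extensions k e) len (∈-extensions e l nb)))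
        where
        sub : map f (cycles u v) ⊆ extensions d e
        sub x∈ with ∈.∈-map⁻ f x∈
        ... | c , c∈ , refl with sound c∈
        ...   | len , nb = subst (λ k → f c ∈ extensions k e) len (∈-extensions e (f c) nb)
      rejoin : ∀ {c c′} → c ∈ cycles u v → c′ ∈ cycles u v → arcᵛ c ≡ arcᵛ c′ → arcᵘ c ≡ arcᵘ c′ → c ≡ c′
      rejoin c∈ c′∈ eqᵛ eqᵘ = trans (Arcs.joined (arcs c∈)) (trans
        (cong₂ (λ p q → u ∷ v ∷ take e p ++ reverse q) eqᵛ eqᵘ) (sym (Arcs.joined (arcs c′∈))))
      injᵛ : ∀ {c c′} → c ∈ cycles u v → c′ ∈ cycles u v → arcᵛ c ≡ arcᵛ c′ → c ≡ c′
      injᵛ {c} {c′} c∈ c′∈ eq = rejoin c∈ c′∈ eq (NB-unique _ _ (NB-tail A.nbᵘ) (NB-tail A′.nbᵘ)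
        (trans (sym A.meet) (trans (cong (lastOf v) eq) A′.meet)) (same-length (arcᵘ c) (arcᵘ c′) A.lenᵘ A′.lenᵘ))
        where
        module A = Arcs (arcs c∈)
        module A′ = Arcs (arcs c′∈)
      injᵘ : ∀ {c c′} → c ∈ cycles u v → c′ ∈ cycles u v → arcᵘ c ≡ arcᵘ c′ → c ≡ c′
      injᵘ {c} {c′} c∈ c′∈ eq = rejoin c∈ c′∈ (NB-unique _ _ (NB-tail A.nbᵛ) (NB-tail A′.nbᵛ)
        (trans A.meet (trans (cong (lastOf u) eq) (sym A′.meet))) (same-length (arcᵛ c) (arcᵛ c′) A.lenᵛ A′.lenᵛ)) eq
        where
        module A = Arcs (arcs c∈)
        module A′ = Arcs (arcs c′∈)
      to : ∀ {t} → Away u v d t → Away v u d t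
      to (l , len , nb , refl) with onto (~-sym u~v) arcᵛ (λ c∈ → Arcs.lenᵛ (arcs c∈) , Arcs.nbᵛ (arcs c∈)) injᵛ l len nb
      ... | c , c∈ , refl = arcᵘ c , Arcs.lenᵘ (arcs c∈) , Arcs.nbᵘ (arcs c∈) , sym (Arcs.meet (arcs c∈))
      from : ∀ {t} → Away v u d t → Away u v d t
      from (l , len , nb , refl) with onto u~v arcᵘ (λ c∈ → Arcs.lenᵘ (arcs c∈) , Arcs.nbᵘ (arcs c∈)) injᵘ l len nb
      ... | c , c∈ , refl = arcᵛ c , Arcs.lenᵛ (arcs c∈) , Arcs.nbᵛ (arcs c∈) , Arcs.meet (arcs c∈)

  -- Balls of radius `d` are closed under adjacency

  module Ball {n : ℕ} (Γ : Graph n) (cubic : ∀ v → degree Γ v ≡ 3) (e : ℕ)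
    (acyclic : ∀ k → k < 2 * suc e + 1 → HasCycleOfLength Γ k → ⊥) where

    open Cycles Γ cubic e acyclic public

    Walk : V → ℕ → V → Set
    Walk x k t = ∃ λ l → length l ≡ k × NB (x ∷ l) × lastOf x l ≡ t

    Walk-unique : ∀ {x t j k} (p : Walk x j t) (q : Walk x k t) → j + k < g → proj₁ p ≡ proj₁ q
    Walk-unique (p , refl , nbp , lp) (q , refl , nbq , lq) = NB-unique p q nbp nbq (trans lp (sym lq))

    reverse-walk : ∀ {x k t} → Walk x k t → Walk t k x
    reverse-walk {x} (l , refl , nb , refl) with ʳ++-∷ x l [] | NB-reverse nb
    ... | m , eq , len , last | nb′ = m , trans len (ℕ.+-identityʳ _) , subst NB eq nb′ , last

    Away⇒Walk : ∀ {p x k t} → Away p x k t → Walk x k t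
    Away⇒Walk (l , len , nb , last) = l , len , NB-tail nb , last

    reverse-away : ∀ {p x k t} → Away p x k t → ∃ λ m → length m ≡ k × NB (t ∷ m ++ [ p ]) × lastOf t m ≡ x
    reverse-away {p} {x} (l , refl , nb , refl) with ʳ++-∷ x l [] | NB-reverse nb
    ... | m , eq , len , last | nb′ = m , trans len (ℕ.+-identityʳ _)
      , subst NB (trans (List.unfold-reverse p (x ∷ l)) (cong (_++ [ p ]) eq)) nb′ , last

    firstStep : ∀ {p x k t} → p ~ x → Walk x k t → (∃ λ j → k ≡ suc j × Away x p j t) ⊎ Away p x k t
    firstStep p~x ([] , len , nb , last) = inj₂ ([] , len , cons p~x tt nb , last)
    firstStep {p} p~x (y ∷ l , len , nb , last) with p ≟ y
    ... | yes refl = inj₁ (length l , sym len , l , refl , nb , last)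
    ... | no  p≢y  = inj₂ (y ∷ l , len , cons p~x p≢y nb , last)

    Near : ℕ → V → V → Set
    Near K x t = ∃ λ k → k ≤ K × Walk x k t

    Near-sym : ∀ {K x t} → Near K x t → Near K t x
    Near-sym (k , k≤ , w) = k , k≤ , reverse-walk w

    prepend : ∀ {K p x t} → p ~ x → Near K x t → Near (suc K) p t
    prepend p~x (k , k≤ , w) with firstStep p~x w
    ... | inj₁ (j , refl , away) = j , ℕ.≤-trans (ℕ.n≤1+n j) (ℕ.≤-trans k≤ (ℕ.n≤1+n _)) , Away⇒Walk away
    ... | inj₂ (l , len , nb , last) = suc k , s≤s k≤ , _ ∷ l , cong suc len , nb , last

    third : ∀ {x w z q r} → w ~ x → w ~ z → w ~ q → w ~ r → z ≢ x → q ≢ x → r ≢ x → q ≢ z → r ≢ z → q ≡ r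
    third w~x w~z w~q w~r z≢x q≢x r≢x q≢z r≢z with only w~z | only w~q | only w~r
      where open Others (others w~x)
    ... | inj₁ z≡x       | _               | _               = contradiction z≡x z≢x
    ... | inj₂ _         | inj₁ q≡x        | _               = contradiction q≡x q≢x
    ... | inj₂ _         | inj₂ _          | inj₁ r≡x        = contradiction r≡x r≢x
    ... | inj₂ _         | inj₂ (inj₁ q≡a) | inj₂ (inj₁ r≡a) = trans q≡a (sym r≡a)
    ... | inj₂ _         | inj₂ (inj₂ q≡b) | inj₂ (inj₂ r≡b) = trans q≡b (sym r≡b)
    ... | inj₂ (inj₁ z≡a) | inj₂ (inj₁ q≡a) | inj₂ (inj₂ _)   = contradiction (trans q≡a (sym z≡a)) q≢z
    ... | inj₂ (inj₁ z≡a) | inj₂ (inj₂ _)   | inj₂ (inj₁ r≡a) = contradiction (trans r≡a (sym z≡a)) r≢z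
    ... | inj₂ (inj₂ z≡b) | inj₂ (inj₂ q≡b) | inj₂ (inj₁ _)   = contradiction (trans q≡b (sym z≡b)) q≢z
    ... | inj₂ (inj₂ z≡b) | inj₂ (inj₁ _)   | inj₂ (inj₂ r≡b) = contradiction (trans r≡b (sym z≡b)) r≢z

    NB-∷ʳ : ∀ {t} x l → NB (t ∷ reverse (x ∷ l)) → NB (x ∷ l ++ [ t ])
    NB-∷ʳ {t} x l nb = subst NB eq (NB-reverse nb)
      where
      eq : reverse (t ∷ reverse (x ∷ l)) ≡ x ∷ l ++ [ t ]
      eq = trans (List.unfold-reverse t (reverse (x ∷ l))) (cong (_++ [ t ]) (List.reverse-involutive (x ∷ l)))

    -- The full edge w x need not be the first one of the walk z w x … u of length d + 1:
    -- the two walks beyond u reach the far side of w x, and by the girth not both of them through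
    -- the neighbour of w other than x and z.
    shortcut : ∀ {z w x l u} → Full w x → NB (z ∷ w ∷ x ∷ l) → length (x ∷ l) ≡ d → lastOf x l ≡ u → Near d z u
    shortcut {z} {w} {x} {l} {u} f (cons z~w z≢x nb) len refl with ʳ++-∷ w (x ∷ l) [] | NB-reverse nb
    ... | [] , eq , lenm , lastm | _ with () ← trans lenm (cong suc (ℕ.+-identityʳ _))
    ... | p ∷ m , eq , lenm , lastm | nbr with subst NB eq nbr
    ...   | nbR = search (beyond U.v~a U.p≢a) (beyond U.v~b U.p≢b)
      where
      module U = Others (others (NB-head nbR))
      w~x : w ~ x
      w~x = NB-head nb
      beyond : ∀ {t} → u ~ t → p ≢ t → Away x w d t
      beyond {t} u~t p≢t = Full.into f
        (l ++ [ t ] , trans (List.length-++ l) (trans (ℕ.+-comm _ 1) len)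
        , NB-∷ʳ w (x ∷ l) (subst (NB ∘ (t ∷_)) (sym eq) (cons (~-sym u~t) (≢-sym p≢t) nbR)) , lastOf-∷ʳ x l t)
      through : ∀ {t m} → u ~ t → length m ≡ e → NB (z ∷ m) → lastOf z m ≡ t → Near d z u
      through u~t lenm nbm lastm = Near-sym (prepend u~t (Near-sym (e , ℕ.≤-refl , _ , lenm , nbm , lastm)))
      avoid : ∀ {t q m} → u ~ t → NB (x ∷ w ∷ q ∷ m) → length m ≡ e → lastOf q m ≡ t → Away u t e q
      avoid {t} {q} {m} u~t nbm lenm lastm with firstStep u~t (reverse-walk (m , lenm , NB-tail (NB-tail nbm) , lastm))
      ... | inj₂ away = away
      -- A walk to `q` back through `u` would leave one of length `e - 1` from `u` to `q`. The walk
      -- from `u` through `x` and `w` to `q` has length `d + 1`, and the sum `2 d - 1` is below `g`.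
      ... | inj₁ (j , e≡ , away) = contradiction (Away⇒Walk away) tooShort
        where
        long : Walk u (suc d) q
        long = reverse-walk (w ∷ x ∷ l , cong suc len , cons (~-sym (NB-head (NB-tail nbm))) (≢-sym (NB-off nbm)) nb , refl)
        tooShort : ¬ Walk u j q
        tooShort short@(s , lens , _) with Walk-unique short long (ℕ.≤-trans (s≤s (ℕ.≤-reflexive (trans (ℕ.+-suc j d) (cong (_+ d) (sym e≡))))) (ℕ.≤-trans (s≤s (ℕ.+-monoˡ-≤ d (ℕ.n≤1+n e))) d+d<g))
        ... | s≡ = ℕ.<⇒≢ (s≤s (ℕ.≤-trans (ℕ.n≤1+n j) (ℕ.≤-trans (ℕ.≤-reflexive (sym e≡)) (ℕ.n≤1+n e)))) (trans (sym lens) (trans (cong length s≡) (proj₁ (proj₂ long))))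
      search : Away x w d U.a → Away x w d U.b → Near d z u
      search (q ∷ m , lenq , nbq , lastq) (r ∷ k , lenr , nbr , lastr) with q ≟ z | r ≟ z
      ... | yes refl | _        = through U.v~a (ℕ.suc-injective lenq) (NB-tail (NB-tail nbq)) lastq
      ... | no _     | yes refl = through U.v~b (ℕ.suc-injective lenr) (NB-tail (NB-tail nbr)) lastr
      ... | no q≢z   | no r≢z with third w~x (~-sym z~w) (NB-head (NB-tail nbq)) (NB-head (NB-tail nbr)) z≢x (≢-sym (NB-off nbq)) (≢-sym (NB-off nbr)) q≢z r≢z
      ...   | refl = contradiction (meet (avoid U.v~a nbq (ℕ.suc-injective lenq) lastq) (avoid U.v~b nbr (ℕ.suc-injective lenr) lastr)) U.a≢b
        where
        meet : ∀ {s t} → Away u s e q → Away u t e q → s ≡ t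
        meet (_ , ls , ns , es) (_ , lt , nt , et) =
          List.∷-injectiveˡ (Walk-unique (_ , cong suc ls , ns , es) (_ , cong suc lt , nt , et) d+d<g)

    module Matched (mate : ∀ u → ∃ (Full u)) where

      -- w has distance d from both ends of the full edge u v, via x and y; z is its third neighbour.
      beyond-middle : ∀ {u v w x l y m z} → Full u v → z ~ w → z ≢ x →
        NB (w ∷ x ∷ l) → length (x ∷ l) ≡ d → lastOf x l ≡ u →
        NB (w ∷ y ∷ m ++ [ u ]) → length (y ∷ m) ≡ d → lastOf y m ≡ v → Near d z u
      beyond-middle {u} {v} {w} {x} {l} {y} {m} {z} uv z~w z≢x nbx lenx lastx nby leny lasty with z ≟ y
      ... | yes refl = d , ℕ.≤-refl , m ++ [ u ] , trans (List.length-++ m) (trans (ℕ.+-comm _ 1) leny) , NB-tail nby , lastOf-∷ʳ y m u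
      ... | no z≢y = go (mate w)
        where
        nbzx : NB (z ∷ w ∷ x ∷ l)
        nbzx = cons z~w z≢x nbx
        nbzy : NB (z ∷ w ∷ y ∷ m)
        nbzy = cons z~w z≢y (NB-++ (y ∷ m) [ u ] nby)
        x≢y : x ≢ y
        x≢y refl with Walk-unique (l , refl , NB-tail nbx , lastx) (m ++ [ u ] , refl , NB-tail nby , lastOf-∷ʳ y m u)
          (ℕ.≤-trans (s≤s (ℕ.+-mono-≤ (ℕ.≤-trans (ℕ.n≤1+n _) (ℕ.≤-reflexive lenx)) (ℕ.≤-reflexive (trans (List.length-++ m) (trans (ℕ.+-comm _ 1) leny))))) d+d<g)
        ... | l≡ = ℕ.1+n≢n (trans (trans (ℕ.+-comm 1 (length m)) (sym (List.length-++ m))) (trans (cong length (sym l≡)) (ℕ.suc-injective (trans lenx (sym leny)))))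
        go : ∃ (Full w) → Near d z u
        -- The neighbours of `w` are `x`, `y`, `z`, and one of them is its mate. The mate `z`
        -- exchanges the walk `z w x … u` at once, and for `x` there is `shortcut`. For `y`,
        -- `shortcut` only brings `z` near `v`; `finish` passes from `v` to `u`, by the edge itself
        -- or, at length exactly `d`, by its fullness.
        go (q , wq) with q ≟ z | q ≟ x
        ... | yes refl | _ = d , ℕ.≤-refl , Away⇒Walk (Full.into (Full-sym wq) (x ∷ l , lenx , nbzx , lastx))
        ... | no _ | yes refl = shortcut wq nbzx lenx lastx
        ... | no q≢z | no q≢x with third (NB-head nbx) (~-sym z~w) (Full.edge wq) (NB-head nby) z≢x q≢x (≢-sym x≢y) q≢z (≢-sym z≢y)
        ...   | refl = finish (shortcut wq nbzy leny lasty)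
          where
          finish : Near d z v → Near d z u
          finish (k , k≤d , walk) with ℕ.m≤n⇒m<n∨m≡n k≤d
          ... | inj₁ (s≤s k≤e) = Near-sym (prepend (Full.edge uv) (Near-sym (k , k≤e , walk)))
          ... | inj₂ refl with firstStep (Full.edge uv) (reverse-walk walk)
          ...   | inj₁ (j , eq , away) = Near-sym (j , ℕ.≤-trans (ℕ.n≤1+n j) (ℕ.≤-reflexive (sym eq)) , Away⇒Walk away)
          ...   | inj₂ away = Near-sym (d , ℕ.≤-refl , Away⇒Walk (Full.into uv away))

      -- The only serious case is a nonbacktracking walk `z w … u` of length `d + 1`. If it enters
      -- `u` from the mate `v` of `u`, fullness of `u v` replaces it by one of length `d`. Otherwise
      -- fullness gives `w` a walk of length `d` to `v` as well, and `beyond-middle` applies.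
      closed : ∀ {u w z} → w ~ z → Near d w u → Near d z u
      closed {u} {w} {z} w~z (k , k≤d , walk) with firstStep (~-sym w~z) walk
      ... | inj₁ (j , refl , away) = j , ℕ.≤-trans (ℕ.n≤1+n j) k≤d , Away⇒Walk away
      ... | inj₂ away@(l , len , nb , last) with ℕ.m≤n⇒m<n∨m≡n k≤d
      ...   | inj₁ k<d = suc k , k<d , w ∷ l , cong suc len , nb , last
      ...   | inj₂ refl with mate u
      ...     | v , uv with firstStep (~-sym (Full.edge uv)) (reverse-walk (w ∷ l , cong suc len , nb , last))
      ...       | inj₁ (_ , refl , back) = Near-sym (d , ℕ.≤-refl , Away⇒Walk (Full.into uv back))
      ...       | inj₂ (m , lenm , nbm , lastm) with split-middle d 0 m (trans lenm (ℕ.+-comm 1 d))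
      ...         | m₁ , z′ , [] , refl , len₁ , _ with trans (sym (lastOf-∷ʳ u m₁ z′)) lastm
      ...           | refl = opposite (Full.back uv (m₁ , len₁ , NB-++ (u ∷ m₁) [ z ] nbm , refl)) (ʳ++-∷ u m₁ [])
        where
        opposite : Away u v d (lastOf u m₁) →
          (∃ λ r → reverse (u ∷ m₁) ≡ lastOf u m₁ ∷ r × length r ≡ length m₁ + 0 × lastOf (lastOf u m₁) r ≡ u) → Near d z u
        opposite across (r , eqr , lenr , lastr) with reverse-away across | trans lenr (trans (ℕ.+-identityʳ _) len₁)
          | subst NB (trans (List.reverse-++ (u ∷ m₁) [ z ]) (cong (z ∷_) eqr)) (NB-reverse (NB-tail nbm))
        opposite across (x ∷ r , _ , _ , lastr) | y ∷ q , lenq , nbq , lastq | lenx | nbz =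
          beyond-middle uv (NB-head nbz) (NB-off nbz) (NB-tail nbz) lenx lastr nbq lenq lastq

      near : Connected Γ → ∀ x u → Near d x u
      near connected x u = along (connected u x) (0 , z≤n , [] , refl , [-] , refl)
        where
        along : ∀ {a} → Reach Γ a x → Near d a u → Near d x u
        along here       a = a
        along (step e r) a = along r (closed e a)

-- Multiplicities modulo powers of two

module _ where

  open import Data.Nat as ℕ using (ℕ; zero; suc; z≤n; s≤s; _∸_)
  import Data.Nat.Divisibility as ℕ∣
  open import Data.Integer using (ℤ; NonZero; +_; -[1+_]; _+_; _*_; _-_; -_; 0ℤ; 1ℤ)
  import Data.Integer.Properties as ℤ
  open import Data.Integer.Divisibility.Signed
    using (_∣_; divides; _∣?_; ∣⇒∣ᵤ; ∣m∣n⇒∣m+n; ∣m⇒∣m*n; ∣n⇒∣m*n; ∣m∣n⇒∣m-n; *-monoʳ-∣)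
  open import Data.Integer.DivMod using (_%ℕ_; _/ℕ_; n%ℕd<d; a≡a%ℕn+[a/ℕn]*n)
  open import Data.Integer.Tactic.RingSolver using (solve-∀)
  open import Data.Bool using (if_then_else_)
  open import Data.Fin using (zero; suc; toℕ; fromℕ<; _≟_)
  import Data.Fin.Properties as Fin
  open import Algebra.Properties.Semiring.Sum ℤ.+-*-semiring
    using (sum; sum-cong-≗; ∑-distrib-+; ∑-comm; *-distribˡ-sum; *-distribʳ-sum; sum-replicate-zero)

  -- Congruences and units modulo powers of two

  infix 4 _≈_[_]
  record _≈_[_] (a b m : ℤ) : Set where
    constructor mod
    field
      quot : ℤ
      eq   : a ≡ b + quot * m

  module _ {m : ℤ} where

    ≈-reflexive : ∀ {a b} → a ≡ b → a ≈ b [ m ]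
    ≈-reflexive {a} refl = mod 0ℤ (sym (ℤ.+-identityʳ a))

    ≈-refl : ∀ {a} → a ≈ a [ m ]
    ≈-refl = ≈-reflexive refl

    ≈-sym : ∀ {a b} → a ≈ b [ m ] → b ≈ a [ m ]
    ≈-sym {a} {b} (mod q refl) = mod (- q) (lemma b q m)
      where
      lemma : ∀ b q m → b ≡ b + q * m + - q * m
      lemma = solve-∀

    ≈-trans : ∀ {a b c} → a ≈ b [ m ] → b ≈ c [ m ] → a ≈ c [ m ]
    ≈-trans {c = c} (mod q refl) (mod r refl) = mod (q + r) (lemma c q r m)
      where
      lemma : ∀ c q r m → c + r * m + q * m ≡ c + (q + r) * m
      lemma = solve-∀

    +-cong : ∀ {a b c d} → a ≈ b [ m ] → c ≈ d [ m ] → a + c ≈ b + d [ m ]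
    +-cong {b = b} {d = d} (mod q refl) (mod r refl) = mod (q + r) (lemma b d q r m)
      where
      lemma : ∀ b d q r m → b + q * m + (d + r * m) ≡ b + d + (q + r) * m
      lemma = solve-∀

    *-cong : ∀ {a b c d} → a ≈ b [ m ] → c ≈ d [ m ] → a * c ≈ b * d [ m ]
    *-cong {b = b} {d = d} (mod q refl) (mod r refl) = mod (q * d + b * r + q * m * r) (lemma b d q r m)
      where
      lemma : ∀ b d q r m → (b + q * m) * (d + r * m) ≡ b * d + (q * d + b * r + q * m * r) * m
      lemma = solve-∀

    *-congˡ : ∀ a {b c} → b ≈ c [ m ] → a * b ≈ a * c [ m ]
    *-congˡ a = *-cong (≈-refl {a})

    *-congʳ : ∀ c {a b} → a ≈ b [ m ] → a * c ≈ b * c [ m ]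
    *-congʳ c p = *-cong p (≈-refl {c})

    sum-cong : ∀ {n} {f g : Fin n → ℤ} → (∀ i → f i ≈ g i [ m ]) → sum f ≈ sum g [ m ]
    sum-cong {zero}  p = ≈-refl
    sum-cong {suc n} p = +-cong (p zero) (sum-cong (λ i → p (suc i)))

  ≈-weaken : ∀ {a b} k {m} → a ≈ b [ k * m ] → a ≈ b [ m ]
  ≈-weaken {b = b} k {m} (mod q refl) = mod (q * k) (cong (λ s → b + s) (sym (ℤ.*-assoc q k m)))

  ≈-scale : ∀ {a b} k {m} → a ≈ b [ m ] → k * a ≈ k * b [ k * m ]
  ≈-scale {b = b} k {m} (mod q refl) = mod q (lemma k b q m)
    where
    lemma : ∀ k b q m → k * (b + q * m) ≡ k * b + q * (k * m)
    lemma = solve-∀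

  ≈-cancel : ∀ {a b} k .{{_ : NonZero k}} {m} → k * a ≈ k * b [ k * m ] → a ≈ b [ m ]
  ≈-cancel {a} {b} k {m} (mod q eq) = mod q (ℤ.*-cancelˡ-≡ k a (b + q * m) (trans eq (lemma k b q m)))
    where
    lemma : ∀ k b q m → k * b + q * (k * m) ≡ k * (b + q * m)
    lemma = solve-∀

  ∣⇒≈0 : ∀ {a m} → m ∣ a → a ≈ 0ℤ [ m ]
  ∣⇒≈0 (divides q eq) = mod q (trans eq (sym (ℤ.+-identityˡ _)))

  ≈⇒∣ : ∀ {a b m} → a ≈ b [ m ] → m ∣ b → m ∣ a
  ≈⇒∣ (mod q refl) m∣b = ∣m∣n⇒∣m+n m∣b (divides q refl)

  sum-∣ : ∀ {n m} {f : Fin n → ℤ} → (∀ i → m ∣ f i) → m ∣ sum f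
  sum-∣ {zero}  p = divides 0ℤ refl
  sum-∣ {suc n} p = ∣m∣n⇒∣m+n (p zero) (sum-∣ (λ i → p (suc i)))

  pow2 : ℕ → ℤ
  pow2 zero    = 1ℤ
  pow2 (suc k) = + 2 * pow2 k

  Odd : ℤ → Set
  Odd a = ∃ λ k → a ≡ 1ℤ + + 2 * k

  even⊎odd : ∀ a → + 2 ∣ a ⊎ Odd a
  even⊎odd a with a %ℕ 2 | n%ℕd<d a 2 | a≡a%ℕn+[a/ℕn]*n a 2
  ... | 0 | _ | eq = inj₁ (divides (a /ℕ 2) (trans eq (ℤ.+-identityˡ _)))
  ... | 1 | _ | eq = inj₂ (a /ℕ 2 , trans eq (cong (λ s → 1ℤ + s) (ℤ.*-comm (a /ℕ 2) (+ 2))))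
  ... | suc (suc _) | s≤s (s≤s ()) | _

  -- Lifting: if `a x = 1 + q 2^K`, then `a (x + q 2^K) = 1 + q (1 + a) 2^K`, and `1 + a` is even.
  odd-invertible : ∀ {a} → Odd a → ∀ K → ∃ λ x → a * x ≈ 1ℤ [ pow2 K ]
  odd-invertible {a} odd zero = 0ℤ , mod (a * 0ℤ - 1ℤ) (lemma (a * 0ℤ))
    where
    lemma : ∀ b → b ≡ 1ℤ + (b - 1ℤ) * 1ℤ
    lemma = solve-∀
  odd-invertible {a} odd@(k , refl) (suc K) with odd-invertible odd K
  ... | x , mod q eq = x + q * pow2 K , mod (q * (1ℤ + k))
    (trans (lemma₁ a x q (pow2 K)) (trans (cong (_+ a * (q * pow2 K)) eq) (lemma₂ k q (pow2 K))))
    where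
    lemma₁ : ∀ a x q p → a * (x + q * p) ≡ a * x + a * (q * p)
    lemma₁ = solve-∀
    lemma₂ : ∀ k q p → 1ℤ + q * p + (1ℤ + + 2 * k) * (q * p) ≡ 1ℤ + q * (1ℤ + k) * (+ 2 * p)
    lemma₂ = solve-∀

  sum-linear : ∀ {n} (f g : Fin n → ℤ) p → sum (λ i → f i + p * g i) ≡ sum f + p * sum g
  sum-linear f g p = trans (∑-distrib-+ f (λ i → p * g i)) (cong (λ s → sum f + s) (sym (*-distribˡ-sum p g)))

  -- Multiples of idempotent matrices and their traces

  Matrix : ℕ → Set
  Matrix n = Fin n → Fin n → ℤ

  module _ {n : ℕ} where

    infixl 7 _⊗_
    _⊗_ : Matrix n → Matrix n → Matrix n
    (E ⊗ F) i j = sum (λ k → E i k * F k j)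

    trace : Matrix n → ℤ
    trace F = sum (λ i → F i i)

    -- For a unit `c` this says that `F / c` is idempotent; the form given also makes sense when `c`
    -- is even.
    Scaled : ℤ → ℤ → Matrix n → Set
    Scaled m c F = ∀ i j → (F ⊗ F) i j ≈ c * F i j [ m ]

    -- Subtracts the rank-one matrix `Q` = (column `j`) `x` (row `i`). When `F F = c F` and `x`
    -- inverts `F i j`, one has `F Q = Q F = Q Q = c Q`, and `Q` has trace `c`. So `F - Q` is scaled
    -- by `c` again and its trace is smaller by `c`.
    eliminate : Matrix n → Fin n → Fin n → ℤ → Matrix n
    eliminate F i j x k l = F k l - F k j * x * F i l

    module _ {m} (c : ℤ) (F : Matrix n) (i j : Fin n) (x : ℤ) (sq : Scaled m c F) (inv : F i j * x ≈ 1ℤ [ m ]) where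

      eliminate-scaled : Scaled m c (eliminate F i j x)
      eliminate-scaled k l = ≈-trans (≈-reflexive expand) (≈-trans
        (+-cong (+-cong (+-cong (sq k l) (*-congˡ (- (x * F i l)) (sq k j))) (*-congˡ (- (F k j * x)) (sq i l)))
          (*-congˡ (F k j * x * x * F i l) (sq i j)))
        (≈-trans (≈-reflexive (collect c (F k l) (F k j) (F i l) (F i j) x))
          (≈-trans (+-cong (≈-refl {a = c * F k l - + 2 * (c * F k j * x * F i l)}) (*-congˡ (c * F k j * x * F i l) inv))
            (≈-reflexive (finish c (F k l) (F k j) (F i l) x)))))
        where
        term : ∀ km im ml mj kj il x → (km - kj * x * im) * (ml - mj * x * il) ≡
          km * ml + - (x * il) * (km * mj) + - (kj * x) * (im * ml) + (kj * x * x * il) * (im * mj)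
        term = solve-∀
        expand : (eliminate F i j x ⊗ eliminate F i j x) k l ≡
          (F ⊗ F) k l + - (x * F i l) * (F ⊗ F) k j + - (F k j * x) * (F ⊗ F) i l + (F k j * x * x * F i l) * (F ⊗ F) i j
        expand = trans (sum-cong-≗ (λ r → term (F k r) (F i r) (F r l) (F r j) (F k j) (F i l) x))
          (trans (sum-linear (λ r → f r + p * g r + q * h r) (λ r → F i r * F r j) (F k j * x * x * F i l))
          (cong (_+ (F k j * x * x * F i l) * (F ⊗ F) i j)
          (trans (sum-linear (λ r → f r + p * g r) h q) (cong (_+ q * sum h) (sum-linear f g p)))))
          where
          p = - (x * F i l)
          q = - (F k j * x)
          f g h : Fin n → ℤ
          f r = F k r * F r l
          g r = F k r * F r j
          h r = F i r * F r l
        collect : ∀ c kl kj il ij x →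
          c * kl + - (x * il) * (c * kj) + - (kj * x) * (c * il) + (kj * x * x * il) * (c * ij)
          ≡ c * kl - + 2 * (c * kj * x * il) + c * kj * x * il * (ij * x)
        collect = solve-∀
        finish : ∀ c kl kj il x → c * kl - + 2 * (c * kj * x * il) + c * kj * x * il * 1ℤ ≡ c * (kl - kj * x * il)
        finish = solve-∀

      eliminate-trace : trace F ≈ trace (eliminate F i j x) + c [ m ]
      eliminate-trace = ≈-sym (≈-trans (+-cong (≈-reflexive expand) (≈-refl {a = c}))
        (≈-trans (+-cong (+-cong (≈-refl {a = trace F}) (*-congˡ (- x) (sq i j))) (≈-refl {a = c}))
        (≈-trans (≈-reflexive (collect (trace F) x c (F i j))) (≈-trans (+-cong (≈-refl {a = trace F + c}) (*-congˡ (- c) inv)) (≈-reflexive (finish (trace F) c))))))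
        where
        term : ∀ kk kj ik x → kk - kj * x * ik ≡ kk + - x * (ik * kj)
        term = solve-∀
        expand : trace (eliminate F i j x) ≡ trace F + - x * (F ⊗ F) i j
        expand = trans (sum-cong-≗ (λ k → term (F k k) (F k j) (F i k) x)) (sum-linear (λ k → F k k) (λ k → F i k * F k j) (- x))
        collect : ∀ t x c f → t + - x * (c * f) + c ≡ t + c + - c * (f * x)
        collect = solve-∀
        finish : ∀ t c → t + c + - c * 1ℤ ≡ t
        finish = solve-∀

      eliminate-pivot : ∀ l → eliminate F i j x i l ≈ 0ℤ [ m ]
      eliminate-pivot l = ≈-trans (+-cong (≈-refl {a = F i l}) (≈-trans (≈-reflexive (ℤ.neg-distribˡ-* (F i j * x) (F i l))) (*-congʳ (F i l) (*-congˡ′ inv)))) (≈-reflexive (finish (F i l)))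
        where
        *-congˡ′ : ∀ {a} → a ≈ 1ℤ [ m ] → - a ≈ - 1ℤ [ m ]
        *-congˡ′ {a} (mod q refl) = mod (- q) (lemma q m)
          where
          lemma : ∀ q m → - (1ℤ + q * m) ≡ - 1ℤ + - q * m
          lemma = solve-∀
        finish : ∀ a → a + - 1ℤ * a ≡ 0ℤ
        finish = solve-∀

    EvenRow : Matrix n → Fin n → Set
    EvenRow F i = ∀ j → + 2 ∣ F i j

    row-parity : ∀ (F : Matrix n) i → EvenRow F i ⊎ ∃ λ j → Odd (F i j)
    row-parity F i with Fin.any? (λ j → ¬? (+ 2 ∣? F i j))
    ... | no  none = inj₁ λ j → decidable-stable (+ 2 ∣? F i j) (λ odd → none (j , odd))
    ... | yes (j , notEven) with even⊎odd (F i j)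
    ...   | inj₁ even = contradiction even notEven
    ...   | inj₂ odd  = inj₂ (j , odd)

    eliminate-even : ∀ {F i j x k} → EvenRow F k → EvenRow (eliminate F i j x) k
    eliminate-even {F} {i} {j} {x} even l = ∣m∣n⇒∣m-n (even l) (∣m⇒∣m*n (F i l) (∣m⇒∣m*n x (even j)))

    record Reduction (K : ℕ) (c : ℤ) (F : Matrix n) (k : ℕ) : Set where
      field
        residue : Matrix n
        rank    : ℕ
        scaled  : Scaled (pow2 (suc K)) c residue
        even    : ∀ i → toℕ i ℕ.< k → EvenRow residue i
        rank≤   : rank ℕ.≤ k
        trace≈  : trace F ≈ trace residue + + rank * c [ pow2 (suc K) ]

    -- A row containing an odd entry is cleared by one elimination; even rows stay even.
    reduce : ∀ K c F → Scaled (pow2 (suc K)) c F → ∀ k → k ℕ.≤ n → Reduction K c F k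
    reduce K c F sq zero    _   = record
      { residue = F ; rank = 0 ; scaled = sq ; even = λ _ () ; rank≤ = z≤n
      ; trace≈ = ≈-reflexive (sym (trans (cong (λ s → trace F + s) (ℤ.*-zeroˡ c)) (ℤ.+-identityʳ _))) }
    reduce K c F sq (suc k) k<n with reduce K c F sq k (ℕ.<⇒≤ k<n)
    ... | R with row-parity (Reduction.residue R) (fromℕ< k<n)
    ...   | inj₁ evenRow = record
      { residue = residue ; rank = rank ; scaled = scaled ; even = even′ ; rank≤ = ℕ.≤-trans rank≤ (ℕ.n≤1+n k) ; trace≈ = trace≈ }
      where
      open Reduction R
      even′ : ∀ i → toℕ i ℕ.< suc k → EvenRow residue i
      even′ i i≤k with ℕ.m≤n⇒m<n∨m≡n (ℕ.≤-pred i≤k)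
      ... | inj₁ i<k = even i i<k
      ... | inj₂ i≡k = subst (EvenRow residue) (Fin.toℕ-injective (trans (Fin.toℕ-fromℕ< k<n) (sym i≡k))) evenRow
    ...   | inj₂ (j , odd) with odd-invertible odd (suc K)
    ...     | x , inv = record
      { residue = eliminate residue (fromℕ< k<n) j x ; rank = suc rank
      ; scaled = eliminate-scaled c residue (fromℕ< k<n) j x scaled inv ; even = even′ ; rank≤ = s≤s rank≤
      ; trace≈ = ≈-trans trace≈ (≈-trans (+-cong (eliminate-trace c residue (fromℕ< k<n) j x scaled inv) (≈-refl {a = + rank * c}))
          (≈-reflexive (lemma (trace (eliminate residue (fromℕ< k<n) j x)) c (+ rank)))) }
      where
      open Reduction R
      lemma : ∀ t c r → t + c + r * c ≡ t + (1ℤ + r) * c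
      lemma = solve-∀
      even′ : ∀ i → toℕ i ℕ.< suc k → EvenRow (eliminate residue (fromℕ< k<n) j x) i
      even′ i i≤k with ℕ.m≤n⇒m<n∨m≡n (ℕ.≤-pred i≤k)
      ... | inj₁ i<k = eliminate-even {residue} {x = x} (even i i<k)
      ... | inj₂ i≡k = subst (EvenRow (eliminate residue (fromℕ< k<n) j x)) (Fin.toℕ-injective (trans (Fin.toℕ-fromℕ< k<n) (sym i≡k)))
        (λ l → ≈⇒∣ (≈-weaken (pow2 K) (subst (eliminate residue (fromℕ< k<n) j x (fromℕ< k<n) l ≈ 0ℤ [_]) (ℤ.*-comm (+ 2) (pow2 K)) (eliminate-pivot c residue (fromℕ< k<n) j x scaled inv l))) (divides 0ℤ refl))

  pow2-∣ : ∀ {j K} → j ℕ.≤ K → pow2 j ∣ pow2 K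
  pow2-∣ {K = K} z≤n = divides (pow2 K) (sym (ℤ.*-identityʳ _))
  pow2-∣ (s≤s j≤K)  = *-monoʳ-∣ (+ 2) (pow2-∣ j≤K)

  ∣-* : ∀ {a b c d} → a ∣ b → c ∣ d → a * c ∣ b * d
  ∣-* {a} {c = c} (divides q refl) (divides r refl) = divides (q * r) (lemma q a r c)
    where
    lemma : ∀ q a r c → q * a * (r * c) ≡ q * r * (a * c)
    lemma = solve-∀

  ≈⇒∣′ : ∀ {a b k m} → a ≈ b [ m ] → k ∣ m → k ∣ b → k ∣ a
  ≈⇒∣′ (mod q refl) k∣m k∣b = ∣m∣n⇒∣m+n k∣b (∣n⇒∣m*n q k∣m)

  module _ {n : ℕ} where

    -- `E` is `s⁻¹ E E`. If 2 and `2^k` divide all entries of `E`, then `2^(k+1)` divides those of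
    -- the product, so the divisibility climbs up to `K`.
    even-vanishes : ∀ K s (E : Matrix n) → Scaled (pow2 K) s E → Odd s → (∀ i → EvenRow E i) →
                    ∀ i j → pow2 K ∣ E i j
    even-vanishes K s E sq odd even = go K ℕ.≤-refl
      where
      s⁻¹ = proj₁ (odd-invertible odd K)
      fixed : ∀ i j → E i j ≈ s⁻¹ * (E ⊗ E) i j [ pow2 K ]
      fixed i j = ≈-sym (≈-trans (*-congˡ s⁻¹ (sq i j)) (≈-trans (≈-reflexive (rearrange s⁻¹ s (E i j)))
        (≈-trans (*-congʳ (E i j) (proj₂ (odd-invertible odd K))) (≈-reflexive (ℤ.*-identityˡ (E i j))))))
        where
        rearrange : ∀ t s e → t * (s * e) ≡ s * t * e
        rearrange = solve-∀
      go : ∀ k → k ℕ.≤ K → ∀ i j → pow2 k ∣ E i j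
      go zero    _   i j = divides (E i j) (sym (ℤ.*-identityʳ _))
      go (suc k) k<K i j = ≈⇒∣′ (fixed i j) (pow2-∣ k<K)
        (∣n⇒∣m*n s⁻¹ (sum-∣ λ l → ∣-* (even i l) (go k (ℕ.<⇒≤ k<K) l j)))

  -- Clearing one row and column of an odd matrix leaves an even one; half of that is, up to the
  -- unit s, idempotent, so its trace is s times a rank.
  odd-scaled-trace : ∀ {n} (o : Fin n) K s (H : Matrix n) → Scaled (pow2 (3 ℕ.+ K)) (+ 2 * s) H → Odd s →
    (∀ i j → Odd (H i j)) → ∃ λ r → r ℕ.≤ suc n × trace H ≈ + r * (+ 2 * s) [ pow2 (2 ℕ.+ K) ]
  odd-scaled-trace {n} o K s H sq odd allOdd = suc rank , s≤s rank≤ , trace-H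
    where
    x = proj₁ (odd-invertible (allOdd o o) (3 ℕ.+ K))
    inv = proj₂ (odd-invertible (allOdd o o) (3 ℕ.+ K))
    H′ : Matrix n
    H′ = eliminate H o o x
    H≈1 : ∀ i j → H i j ≈ 1ℤ [ + 2 ]
    H≈1 i j with allOdd i j
    ... | k , eq = mod k (trans eq (cong (λ t → 1ℤ + t) (ℤ.*-comm (+ 2) k)))
    x≈1 : x ≈ 1ℤ [ + 2 ]
    x≈1 = ≈-trans (≈-sym (≈-trans (*-congʳ x (H≈1 o o)) (≈-reflexive (ℤ.*-identityˡ x))))
      (≈-weaken (pow2 (2 ℕ.+ K)) (subst (H o o * x ≈ 1ℤ [_]) (ℤ.*-comm (+ 2) (pow2 (2 ℕ.+ K))) inv))
    H′-even : ∀ i j → + 2 ∣ H′ i j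
    H′-even i j = ≈⇒∣ (≈-trans (+-cong (H≈1 i j) (neg (*-cong (*-cong (H≈1 i o) x≈1) (H≈1 o j))))
      (≈-reflexive refl)) (divides 0ℤ refl)
      where
      neg : ∀ {a} → a ≈ 1ℤ [ + 2 ] → - a ≈ - 1ℤ [ + 2 ]
      neg (mod q refl) = mod (- q) (lemma q)
        where
        lemma : ∀ q → - (1ℤ + q * + 2) ≡ - 1ℤ + - q * + 2
        lemma = solve-∀
    F : Matrix n
    F i j = _∣_.quotient (H′-even i j)
    H′≡2F : ∀ i j → H′ i j ≡ F i j * + 2
    H′≡2F i j = _∣_.equality (H′-even i j)
    -- Both factors 2 of `H′ H′` cancel against those in `2 s H′`, at the cost of two powers of two
    -- in the modulus. One comes back in `trace H′ = 2 trace F`, which explains the moduli with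
    -- `3 + K`, `1 + K` and `2 + K`.
    F-scaled : Scaled (pow2 (suc K)) s F
    F-scaled i j = ≈-cancel (+ 2) (≈-cancel (+ 2) (≈-trans (≈-reflexive (sym square))
      (≈-trans (eliminate-scaled (+ 2 * s) H o o x sq inv i j) (≈-reflexive (trans (cong (+ 2 * s *_) (H′≡2F i j)) (rearrange s (F i j)))))))
      where
      rearrange : ∀ s f → + 2 * s * (f * + 2) ≡ + 2 * (+ 2 * (s * f))
      rearrange = solve-∀
      product : ∀ a b → a * + 2 * (b * + 2) ≡ + 4 * (a * b)
      product = solve-∀
      double : ∀ a → + 4 * a ≡ + 2 * (+ 2 * a)
      double = solve-∀
      square : (H′ ⊗ H′) i j ≡ + 2 * (+ 2 * (F ⊗ F) i j)
      square = trans (sum-cong-≗ (λ k → trans (cong₂ _*_ (H′≡2F i k) (H′≡2F k j)) (product (F i k) (F k j))))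
        (trans (sym (*-distribˡ-sum (+ 4) (λ k → F i k * F k j))) (double ((F ⊗ F) i j)))
    open Reduction (reduce K s F F-scaled n ℕ.≤-refl)
    residue≈0 : trace residue ≈ 0ℤ [ pow2 (suc K) ]
    residue≈0 = ∣⇒≈0 (sum-∣ λ i → even-vanishes (suc K) s residue scaled odd (λ i → even i (Fin.toℕ<n i)) i i)
    trace-F : trace F ≈ + rank * s [ pow2 (suc K) ]
    trace-F = ≈-trans trace≈ (≈-trans (+-cong residue≈0 (≈-refl {a = + rank * s})) (≈-reflexive (ℤ.+-identityˡ _)))
    trace-H′ : trace H′ ≡ + 2 * trace F
    trace-H′ = trans (sum-cong-≗ (λ i → trans (H′≡2F i i) (ℤ.*-comm (F i i) (+ 2)))) (sym (*-distribˡ-sum (+ 2) (λ i → F i i)))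
    trace-H : trace H ≈ + suc rank * (+ 2 * s) [ pow2 (2 ℕ.+ K) ]
    trace-H = ≈-trans (≈-weaken (+ 2) (eliminate-trace (+ 2 * s) H o o x sq inv))
      (≈-trans (+-cong (≈-trans (≈-reflexive trace-H′) (≈-scale (+ 2) trace-F)) (≈-refl {a = + 2 * s})) (≈-reflexive (lemma (+ rank) s)))
      where
      lemma : ∀ r s → + 2 * (r * s) + + 2 * s ≡ (1ℤ + r) * (+ 2 * s)
      lemma = solve-∀

  Σ≤ : ℕ → (ℕ → ℤ) → ℤ
  Σ≤ zero    f = f 0
  Σ≤ (suc k) f = Σ≤ k f + f (suc k)

  Σ≤-cong : ∀ k {m} {f g : ℕ → ℤ} → (∀ j → j ℕ.≤ k → f j ≈ g j [ m ]) → Σ≤ k f ≈ Σ≤ k g [ m ]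
  Σ≤-cong zero    p = p 0 z≤n
  Σ≤-cong (suc k) p = +-cong (Σ≤-cong k (λ j j≤k → p j (ℕ.≤-trans j≤k (ℕ.n≤1+n k)))) (p (suc k) ℕ.≤-refl)

  Σ≤-cong-≡ : ∀ k {f g : ℕ → ℤ} → (∀ j → j ℕ.≤ k → f j ≡ g j) → Σ≤ k f ≡ Σ≤ k g
  Σ≤-cong-≡ zero    p = p 0 z≤n
  Σ≤-cong-≡ (suc k) p = cong₂ _+_ (Σ≤-cong-≡ k (λ j j≤k → p j (ℕ.≤-trans j≤k (ℕ.n≤1+n k)))) (p (suc k) ℕ.≤-refl)

  Σ≤-* : ∀ k c f → Σ≤ k (λ j → c * f j) ≡ c * Σ≤ k f
  Σ≤-* zero    c f = refl
  Σ≤-* (suc k) c f = trans (cong (_+ c * f (suc k)) (Σ≤-* k c f)) (sym (ℤ.*-distribˡ-+ c _ _))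

  sum-zero : ∀ {n} {f : Fin n → ℤ} → (∀ i → f i ≡ 0ℤ) → sum f ≡ 0ℤ
  sum-zero {n} p = trans (sum-cong-≗ p) (sum-replicate-zero n)

  sum-single : ∀ {n} {f : Fin n → ℤ} i → (∀ j → j ≢ i → f j ≡ 0ℤ) → sum f ≡ f i
  sum-single {f = f} zero    p = trans (cong (λ s → f zero + s) (sum-zero (λ j → p (suc j) λ ()))) (ℤ.+-identityʳ _)
  sum-single {f = f} (suc i) p = trans (cong₂ _+_ (p zero λ ()) (sum-single i λ j j≢i → p (suc j) (λ eq → j≢i (Fin.suc-injective eq)))) (ℤ.+-identityˡ _)

  sum-const : ∀ n c → sum {n} (λ _ → c) ≡ + n * c
  sum-const zero    c = sym (ℤ.*-zeroˡ c)
  sum-const (suc n) c = trans (cong (λ s → c + s) (sum-const n c)) (lemma c (+ n))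
    where
    lemma : ∀ c n → c + n * c ≡ (1ℤ + n) * c
    lemma = solve-∀

  sum-Σ≤ : ∀ {n} k (f : ℕ → Fin n → ℤ) → sum (λ i → Σ≤ k (λ j → f j i)) ≡ Σ≤ k (λ j → sum (f j))
  sum-Σ≤ zero    f = refl
  sum-Σ≤ (suc k) f = trans (∑-distrib-+ _ (f (suc k))) (cong (_+ sum (f (suc k))) (sum-Σ≤ k f))

  δ : ∀ {n} → Matrix n
  δ i j = if ⌊ i ≟ j ⌋ then 1ℤ else 0ℤ

  δ-refl : ∀ {n} (i : Fin n) → δ i i ≡ 1ℤ
  δ-refl i with i ≟ i
  ... | yes _  = refl
  ... | no i≢i = contradiction refl i≢i

  δ-≢ : ∀ {n} {i j : Fin n} → i ≢ j → δ i j ≡ 0ℤ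
  δ-≢ {i = i} {j} i≢j with i ≟ j
  ... | yes i≡j = contradiction i≡j i≢j
  ... | no _    = refl

  δ-⊗ : ∀ {n} (F : Matrix n) i j → (δ ⊗ F) i j ≡ F i j
  δ-⊗ F i j = trans (sum-single i (λ k k≢i → trans (cong (_* F k j) (δ-≢ (λ eq → k≢i (sym eq)))) (ℤ.*-zeroˡ (F k j))))
    (trans (cong (_* F i j) (δ-refl i)) (ℤ.*-identityˡ _))

  ⊗-assoc : ∀ {n} (D E F : Matrix n) i j → ((D ⊗ E) ⊗ F) i j ≡ (D ⊗ (E ⊗ F)) i j
  ⊗-assoc D E F i j = trans (sum-cong-≗ (λ k → *-distribʳ-sum (F k j) (λ l → D i l * E l k)))
    (trans (∑-comm (λ k l → D i l * E l k * F k j))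
    (sum-cong-≗ λ l → trans (sum-cong-≗ (λ k → ℤ.*-assoc (D i l) (E l k) (F k j))) (sym (*-distribˡ-sum (D i l) (λ k → E l k * F k j)))))

  -- The number of vertices at distance `k` from a given vertex of the cubic tree.
  κ : ℕ → ℤ
  κ zero    = 1ℤ
  κ (suc k) = + 3 * pow2 k

  -- An approximate eigenmatrix of a cubic Moore graph

  module Moore {n : ℕ} (A : Matrix n) (N : ℕ → Matrix n) (d′ : ℕ)
    (N₀  : ∀ i j → N 0 i j ≡ δ i j)
    (N₁  : ∀ i j → N 1 i j ≡ A i j)
    (AN₀ : ∀ i j → (A ⊗ N 0) i j ≡ N 1 i j)
    (AN₁ : ∀ i j → (A ⊗ N 1) i j ≡ N 2 i j + + 3 * N 0 i j)
    (AN  : ∀ k i j → (A ⊗ N (2 ℕ.+ k)) i j ≡ N (3 ℕ.+ k) i j + + 2 * N (1 ℕ.+ k) i j)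
    (top : ∀ i j → N (suc (suc d′)) i j ≡ + 2 * N (suc d′) i j)
    (total : ∀ i j → Σ≤ (suc d′) (λ k → N k i j) ≡ 1ℤ)
    (diagonal : ∀ k → suc k ℕ.≤ (suc d′) → ∀ i → N (suc k) i i ≡ 0ℤ)
    (f : ℕ → ℤ) (u : ℤ)
    (f-odd  : ∀ k → Odd (f k))
    (f-rec  : ∀ k → 2 ℕ.+ k ℕ.≤ (suc d′) → f k + + 2 * f (2 ℕ.+ k) ≡ u * f (1 ℕ.+ k))
    (f-last : f d′ + + 2 * f (suc d′) ≡ u * f (suc d′))
    where

    d : ℕ
    d = suc d′

    -- Comparing coefficients in `A F` and `u F`, `f-rec` and `f-last` settle those of `N 1` up to
    -- `N d`. `P` is the discrepancy left over at `N 0`, which is zero for an exact eigenvalue. `T`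
    -- is the scalar in `H H ≡ T H`.
    P T : ℤ
    P = + 3 * f 1 - u * f 0
    T = Σ≤ d (λ k → κ k * (f k * f k))

    partial : ℕ → Matrix n
    partial k i j = Σ≤ k (λ t → f t * N t i j)

    F : Matrix n
    F = partial d

    ⊗-partial : ∀ D k i j → (D ⊗ partial (suc k)) i j ≡ (D ⊗ partial k) i j + f (suc k) * (D ⊗ N (suc k)) i j
    ⊗-partial D k i j = trans (sum-cong-≗ (λ l → lemma (D i l) (partial k l j) (f (suc k)) (N (suc k) l j)))
      (sum-linear (λ l → D i l * partial k l j) (λ l → D i l * N (suc k) l j) (f (suc k)))
      where
      lemma : ∀ a p c b → a * (p + c * b) ≡ a * p + c * (a * b)
      lemma = solve-∀

    A⊗partial : ∀ k → suc k ℕ.≤ d → ∀ i j → (A ⊗ partial (suc k)) i j ≡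
      u * partial k i j + P * N 0 i j + f k * N (suc k) i j + f (suc k) * N (2 ℕ.+ k) i j
    A⊗partial zero _ i j = trans (⊗-partial A 0 i j) (trans (cong₂ (λ a b → a + f 1 * b)
        (trans (trans (sum-cong-≗ (λ l → swap (A i l) (f 0) (N 0 l j))) (sym (*-distribˡ-sum (f 0) (λ l → A i l * N 0 l j)))) (cong (f 0 *_) (AN₀ i j))) (AN₁ i j))
      (lemma u (f 0) (f 1) (N 0 i j) (N 1 i j) (N 2 i j)))
      where
      swap : ∀ a f n → a * (f * n) ≡ f * (a * n)
      swap = solve-∀
      lemma : ∀ u f₀ f₁ n₀ n₁ n₂ → f₀ * n₁ + f₁ * (n₂ + + 3 * n₀) ≡
        u * (f₀ * n₀) + (+ 3 * f₁ - u * f₀) * n₀ + f₀ * n₁ + f₁ * n₂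
      lemma = solve-∀
    A⊗partial (suc k) k<d i j = trans (⊗-partial A (suc k) i j)
      (trans (cong₂ (λ a b → a + f (2 ℕ.+ k) * b) (A⊗partial k (ℕ.<⇒≤ k<d) i j) (AN k i j))
      (trans (gather (u * partial k i j) (P * N 0 i j) (f k) (f (suc k)) (f (2 ℕ.+ k)) (N (suc k) i j) (N (2 ℕ.+ k) i j) (N (3 ℕ.+ k) i j))
      (trans (cong (λ c → u * partial k i j + P * N 0 i j + c * N (suc k) i j + f (suc k) * N (2 ℕ.+ k) i j + f (2 ℕ.+ k) * N (3 ℕ.+ k) i j) (f-rec k k<d))
        (absorb u (partial k i j) (P * N 0 i j) (f (suc k)) (f (2 ℕ.+ k)) (N (suc k) i j) (N (2 ℕ.+ k) i j) (N (3 ℕ.+ k) i j)))))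
      where
      gather : ∀ a p f₀ f₁ f₂ n₁ n₂ n₃ → a + p + f₀ * n₁ + f₁ * n₂ + f₂ * (n₃ + + 2 * n₁) ≡
        a + p + (f₀ + + 2 * f₂) * n₁ + f₁ * n₂ + f₂ * n₃
      gather = solve-∀
      absorb : ∀ u a p f₁ f₂ n₁ n₂ n₃ → u * a + p + u * f₁ * n₁ + f₁ * n₂ + f₂ * n₃ ≡
        u * (a + f₁ * n₁) + p + f₁ * n₂ + f₂ * n₃
      absorb = solve-∀

    A⊗F : ∀ i j → (A ⊗ F) i j ≡ u * F i j + P * N 0 i j
    A⊗F i j = trans (A⊗partial d′ ℕ.≤-refl i j) (trans (cong (λ t → u * partial d′ i j + P * N 0 i j + f d′ * N d i j + f d * t) (top i j))
      (trans (gather (u * partial d′ i j) (P * N 0 i j) (f d′) (f d) (N d i j))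
      (trans (cong (λ c → u * partial d′ i j + P * N 0 i j + c * N d i j) f-last) (absorb u (partial d′ i j) (P * N 0 i j) (f d) (N d i j)))))
      where
      gather : ∀ a p f₀ f₁ n → a + p + f₀ * n + f₁ * (+ 2 * n) ≡ a + p + (f₀ + + 2 * f₁) * n
      gather = solve-∀
      absorb : ∀ u a p f n → u * a + p + u * f * n ≡ u * (a + f * n) + p
      absorb = solve-∀

    module Modulo (m : ℤ) (P≈0 : P ≈ 0ℤ [ m ]) where

      A⊗F≈ : ∀ i j → (A ⊗ F) i j ≈ u * F i j [ m ]
      A⊗F≈ i j = ≈-trans (≈-reflexive (A⊗F i j)) (≈-trans (+-cong (≈-refl {a = u * F i j}) (*-congʳ (N 0 i j) P≈0))
        (≈-reflexive (trans (cong (λ s → u * F i j + s) (ℤ.*-zeroˡ (N 0 i j))) (ℤ.+-identityʳ _))))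

      -- Each `N k` is a polynomial in `A` and so acts on `F` as a scalar, namely `κ k f k / f 0`;
      -- the factor `f 0` clears the denominator.
      Eigen : ℕ → Set
      Eigen k = ∀ i j → f 0 * (N k ⊗ F) i j ≈ κ k * f k * F i j [ m ]

      eigen₀ : Eigen 0
      eigen₀ i j = ≈-reflexive (trans (cong (f 0 *_) (trans (sum-cong-≗ (λ l → cong (_* F l j) (N₀ i l))) (δ-⊗ F i j)))
        (cong (_* F i j) (sym (ℤ.*-identityˡ (f 0)))))

      eigen₁ : Eigen 1
      eigen₁ i j = ≈-trans (≈-reflexive (cong (f 0 *_) (sum-cong-≗ (λ l → cong (_* F l j) (N₁ i l)))))
        (≈-trans (*-congˡ (f 0) (A⊗F≈ i j)) (≈-trans (≈-reflexive (lemma u (f 0) (f 1) (F i j)))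
        (≈-trans (+-cong (≈-refl {a = + 3 * 1ℤ * f 1 * F i j}) (*-congʳ (- F i j) P≈0)) (≈-reflexive (finish (+ 3 * 1ℤ * f 1 * F i j) (- F i j))))))
        where
        lemma : ∀ u f₀ f₁ x → f₀ * (u * x) ≡ + 3 * 1ℤ * f₁ * x + (+ 3 * f₁ - u * f₀) * - x
        lemma = solve-∀
        finish : ∀ a b → a + 0ℤ * b ≡ a
        finish = solve-∀

      next : ∀ c k → (∀ i j → (A ⊗ N (suc k)) i j ≡ N (2 ℕ.+ k) i j + c * N k i j) → c * κ k ≡ κ (suc k) →
             2 ℕ.+ k ℕ.≤ d → Eigen k → Eigen (suc k) → Eigen (2 ℕ.+ k)
      next c k rec cκ k<d e₀ e₁ i j = ≈-trans (≈-reflexive peeled) (≈-trans (+-cong first (*-congˡ (- c) (e₀ i j))) (≈-reflexive folded))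
        where
        K₁ x : ℤ
        K₁ = κ (suc k)
        x  = F i j
        NF : Matrix n
        NF = N (suc k) ⊗ F
        isolate : ∀ a b c y → a ≡ b + c * y → b ≡ a + - c * y
        isolate a b c y refl = lemma b c y
          where
          lemma : ∀ b c y → b ≡ b + c * y + - c * y
          lemma = solve-∀
        peel : (N (2 ℕ.+ k) ⊗ F) i j ≡ (A ⊗ NF) i j + - c * (N k ⊗ F) i j
        peel = trans (sum-cong-≗ (λ l → trans
            (cong (_* F l j) (isolate ((A ⊗ N (suc k)) i l) (N (2 ℕ.+ k) i l) c (N k i l) (rec i l)))
            (lemma ((A ⊗ N (suc k)) i l) c (N k i l) (F l j))))
          (trans (sum-linear (λ l → (A ⊗ N (suc k)) i l * F l j) (λ l → N k i l * F l j) (- c))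
            (cong (_+ - c * (N k ⊗ F) i j) (⊗-assoc A (N (suc k)) F i j)))
          where
          lemma : ∀ a c n x → (a + - c * n) * x ≡ a * x + - c * (n * x)
          lemma = solve-∀
        spread : ∀ f a c b → f * (a + - c * b) ≡ f * a + - c * (f * b)
        spread = solve-∀
        peeled : f 0 * (N (2 ℕ.+ k) ⊗ F) i j ≡ f 0 * (A ⊗ NF) i j + - c * (f 0 * (N k ⊗ F) i j)
        peeled = trans (cong (f 0 *_) peel) (spread (f 0) ((A ⊗ NF) i j) c ((N k ⊗ F) i j))
        swap : ∀ a b c → a * (b * c) ≡ b * (a * c)
        swap = solve-∀
        inner : f 0 * (A ⊗ NF) i j ≡ sum (λ l → A i l * (f 0 * NF l j))
        inner = trans (*-distribˡ-sum (f 0) (λ l → A i l * NF l j)) (sum-cong-≗ (λ l → swap (f 0) (A i l) (NF l j)))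
        outer : sum (λ l → A i l * (K₁ * f (suc k) * F l j)) ≡ K₁ * f (suc k) * (A ⊗ F) i j
        outer = trans (sum-cong-≗ (λ l → swap (A i l) (K₁ * f (suc k)) (F l j)))
          (sym (*-distribˡ-sum (K₁ * f (suc k)) (λ l → A i l * F l j)))
        first : f 0 * (A ⊗ NF) i j ≈ K₁ * f (suc k) * (u * x) [ m ]
        first = ≈-trans (≈-reflexive inner) (≈-trans (sum-cong (λ l → *-congˡ (A i l) (e₁ l j)))
          (≈-trans (≈-reflexive outer) (*-congˡ (K₁ * f (suc k)) (A⊗F≈ i j))))
        gather : ∀ K f₀ f₁ u x c k → K * f₁ * (u * x) + - c * (k * f₀ * x) ≡ (K * (u * f₁) - c * k * f₀) * x
        gather = solve-∀
        finish : ∀ f₀ f₂ x p → (+ 3 * p * (f₀ + + 2 * f₂) - + 3 * p * f₀) * x ≡ + 3 * (+ 2 * p) * f₂ * x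
        finish = solve-∀
        folded : K₁ * f (suc k) * (u * x) + - c * (κ k * f k * x) ≡ κ (2 ℕ.+ k) * f (2 ℕ.+ k) * x
        folded = trans (gather K₁ (f k) (f (suc k)) u x c (κ k))
          (trans (cong (λ z → (K₁ * (u * f (suc k)) - z * f k) * x) cκ)
          (trans (cong (λ z → (K₁ * z - K₁ * f k) * x) (sym (f-rec k k<d))) (finish (f k) (f (2 ℕ.+ k)) x (pow2 k))))

      eigen : ∀ k → k ℕ.≤ d → Eigen k
      eigen zero          _   = eigen₀
      eigen (suc zero)    _   = eigen₁
      eigen (suc (suc zero)) k≤d = next (+ 3) 0 AN₁ refl k≤d eigen₀ eigen₁
      eigen (suc (suc (suc k))) k≤d = next (+ 2) (suc k) (AN k) (double (pow2 k)) k≤d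
        (eigen (suc k) (ℕ.≤-trans (ℕ.m≤n+m (suc k) 2) k≤d)) (eigen (suc (suc k)) (ℕ.<⇒≤ k≤d))
        where
        double : ∀ p → + 2 * (+ 3 * p) ≡ + 3 * (+ 2 * p)
        double = solve-∀

      H : Matrix n
      H i j = f 0 * F i j

      partial-⊗ : ∀ k i j → (partial k ⊗ F) i j ≡ Σ≤ k (λ t → f t * (N t ⊗ F) i j)
      partial-⊗ zero    i j = trans (sum-cong-≗ (λ l → ℤ.*-assoc (f 0) (N 0 i l) (F l j))) (sym (*-distribˡ-sum (f 0) (λ l → N 0 i l * F l j)))
      partial-⊗ (suc k) i j = trans (sum-cong-≗ (λ l → lemma (partial k i l) (f (suc k)) (N (suc k) i l) (F l j)))
        (trans (sum-linear (λ l → partial k i l * F l j) (λ l → N (suc k) i l * F l j) (f (suc k))) (cong (_+ f (suc k) * (N (suc k) ⊗ F) i j) (partial-⊗ k i j)))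
        where
        lemma : ∀ p c a b → (p + c * a) * b ≡ p * b + c * (a * b)
        lemma = solve-∀

      -- Expanding the left factor, `H H` is `f 0` times the sum of `f k (f 0 N k F)`, and `eigen`
      -- turns each term into `κ k (f k)² F`.
      H-scaled : Scaled m T H
      H-scaled i j = ≈-trans (≈-reflexive (trans (sum-cong-≗ (λ l → lemma (f 0) (F i l) (F l j)))
          (trans (sym (*-distribˡ-sum (f 0 * f 0) (λ l → F i l * F l j))) (trans (cong (f 0 * f 0 *_) (partial-⊗ d i j))
          (trans (ℤ.*-assoc (f 0) (f 0) _) (cong (f 0 *_) (sym (Σ≤-* d (f 0) _))))))))
        (≈-trans (*-congˡ (f 0) (≈-trans (Σ≤-cong d (λ k k≤d → ≈-trans (≈-reflexive (swap (f 0) (f k) ((N k ⊗ F) i j)))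
          (≈-trans (*-congˡ (f k) (eigen k k≤d i j)) (≈-reflexive (shape (f k) (κ k) (F i j)))))) (≈-reflexive (Σ≤-* d (F i j) _))))
          (≈-reflexive (finish (f 0) (F i j) T)))
        where
        lemma : ∀ c a b → c * a * (c * b) ≡ c * c * (a * b)
        lemma = solve-∀
        swap : ∀ a b c → a * (b * c) ≡ b * (a * c)
        swap = solve-∀
        shape : ∀ f k x → f * (k * f * x) ≡ x * (k * (f * f))
        shape = solve-∀
        finish : ∀ f x t → f * (x * t) ≡ t * (f * x)
        finish = solve-∀

    odd⇒≈1 : ∀ {a} → Odd a → a ≈ 1ℤ [ + 2 ]
    odd⇒≈1 (k , eq) = mod k (trans eq (cong (λ t → 1ℤ + t) (ℤ.*-comm (+ 2) k)))

    ≈1⇒odd : ∀ {a} → a ≈ 1ℤ [ + 2 ] → Odd a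
    ≈1⇒odd (mod q eq) = q , trans eq (cong (λ t → 1ℤ + t) (ℤ.*-comm q (+ 2)))

    -- All coefficients are odd, so modulo 2 the matrix is the plain sum of the `N k`, which is all
    -- ones.
    F≈1 : ∀ i j → F i j ≈ 1ℤ [ + 2 ]
    F≈1 i j = ≈-trans (Σ≤-cong d (λ k _ → ≈-trans (*-congʳ (N k i j) (odd⇒≈1 (f-odd k))) (≈-reflexive (ℤ.*-identityˡ (N k i j)))))
      (≈-reflexive (total i j))

    H-odd : ∀ i j → Odd (f 0 * F i j)
    H-odd i j = ≈1⇒odd (≈-trans (*-congˡ (f 0) (F≈1 i j)) (≈-trans (≈-reflexive (ℤ.*-identityʳ (f 0))) (odd⇒≈1 (f-odd 0))))

    F-diagonal : ∀ k → k ℕ.≤ d → ∀ i → partial k i i ≡ f 0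
    F-diagonal zero    _   i = trans (cong (f 0 *_) (trans (N₀ i i) (δ-refl i))) (ℤ.*-identityʳ _)
    F-diagonal (suc k) k<d i = trans (cong₂ _+_ (F-diagonal k (ℕ.<⇒≤ k<d) i) (trans (cong (f (suc k) *_) (diagonal k k<d i)) (ℤ.*-zeroʳ (f (suc k))))) (ℤ.+-identityʳ _)

    H-trace : sum (λ i → f 0 * F i i) ≡ + n * (f 0 * f 0)
    H-trace = trans (sum-cong-≗ (λ i → cong (f 0 *_) (F-diagonal d ℕ.≤-refl i))) (sum-const n (f 0 * f 0))

    multiplicity : Fin n → ∀ K s → P ≈ 0ℤ [ pow2 (3 ℕ.+ K) ] → T ≡ + 2 * s → Odd s →
      ∃ λ r → r ℕ.≤ suc n × + n * (f 0 * f 0) ≈ + r * (+ 2 * s) [ pow2 (2 ℕ.+ K) ]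
    multiplicity o K s P≈0 T≡ odd = proj₁ result , proj₁ (proj₂ result) ,
      ≈-trans (≈-reflexive (sym H-trace)) (proj₂ (proj₂ result))
      where
      m : ℤ
      m = pow2 (3 ℕ.+ K)
      open Modulo m P≈0 using (H; H-scaled)
      scaled : Scaled m (+ 2 * s) H
      scaled i j = ≈-trans (H-scaled i j) (≈-reflexive (cong (_* H i j) T≡))
      result : ∃ λ r → r ℕ.≤ suc n × trace H ≈ + r * (+ 2 * s) [ pow2 (2 ℕ.+ K) ]
      result = odd-scaled-trace o K s H scaled odd H-odd

  -- ψ u j is the coefficient of N (d − j) in the eigenmatrix for u, normalised to 1 at N d.
  ψ : ℤ → ℕ → ℤ
  ψ u zero          = 1ℤ
  ψ u (suc zero)    = u - + 2
  ψ u (suc (suc j)) = u * ψ u (suc j) - + 2 * ψ u j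

  ψ-odd : ∀ {u} → Odd u → ∀ j → Odd (ψ u j)
  ψ-odd odd zero = 0ℤ , refl
  ψ-odd (k , refl) (suc zero) = k - 1ℤ , lemma k
    where
    lemma : ∀ k → 1ℤ + + 2 * k - + 2 ≡ 1ℤ + + 2 * (k - 1ℤ)
    lemma = solve-∀
  ψ-odd {u} odd@(k , refl) (suc (suc j)) with ψ-odd odd (suc j)
  ... | l , eq = k + l + + 2 * (k * l) - ψ u j , trans (cong (λ a → u * a - + 2 * ψ u j) eq) (lemma k l (ψ u j))
    where
    lemma : ∀ k l b → (1ℤ + + 2 * k) * (1ℤ + + 2 * l) - + 2 * b ≡ 1ℤ + + 2 * (k + l + + 2 * (k * l) - b)
    lemma = solve-∀

  -- Unfolded, `S u d` is the sum of `2^(k-1) (ψ u (d - k))²` for `1 ≤ k ≤ d`, that is, a third of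
  -- the part of `T` beyond `k = 0`.
  S : ℤ → ℕ → ℤ
  S u zero    = 0ℤ
  S u (suc j) = + 2 * S u j + ψ u j * ψ u j

  module _ (u : ℤ) where

    reversed : ℕ → ℕ → ℤ
    reversed d k = ψ u (d ∸ k)

    private
      suc-∸ : ∀ {d k} → suc k ℕ.≤ d → d ∸ k ≡ suc (d ∸ suc k)
      suc-∸ {suc d} {zero}  _         = refl
      suc-∸ {suc d} {suc k} (s≤s k<d) = suc-∸ k<d

    reversed-rec : ∀ d k → 2 ℕ.+ k ℕ.≤ d → reversed d k + + 2 * reversed d (2 ℕ.+ k) ≡ u * reversed d (1 ℕ.+ k)
    reversed-rec d k k<d = trans (cong (λ i → ψ u i + + 2 * ψ u (d ∸ (2 ℕ.+ k))) (trans (suc-∸ (ℕ.<⇒≤ k<d)) (cong suc (suc-∸ k<d))))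
      (trans (lemma u (ψ u (suc (d ∸ (2 ℕ.+ k)))) (ψ u (d ∸ (2 ℕ.+ k)))) (cong (λ i → u * ψ u i) (sym (suc-∸ k<d))))
      where
      lemma : ∀ u a b → u * a - + 2 * b + + 2 * b ≡ u * a
      lemma = solve-∀

    reversed-last : ∀ e → reversed (suc e) e + + 2 * reversed (suc e) (suc e) ≡ u * reversed (suc e) (suc e)
    reversed-last e = trans (cong₂ (λ i j → ψ u i + + 2 * ψ u j) (trans (suc-∸ (ℕ.≤-refl {suc e})) (cong suc (ℕ.n∸n≡0 e))) (ℕ.n∸n≡0 e))
      (trans (lemma u) (cong (λ i → u * ψ u i) (sym (ℕ.n∸n≡0 e))))
      where
      lemma : ∀ u → u - + 2 + + 2 * 1ℤ ≡ u * 1ℤ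
      lemma = solve-∀

    -- The terms up to `k` together with the remainder `3 · 2^k S u (d - k)` have a sum independent
    -- of `k`, since one step of the recursion for `S` moves one term over.
    reversed-squares : ∀ d → Σ≤ d (λ k → κ k * (reversed d k * reversed d k)) ≡ ψ u d * ψ u d + + 3 * S u d
    reversed-squares d = trans (sym (trans (cong (λ i → Q d + + 3 * (pow2 d * S u i)) (ℕ.n∸n≡0 d)) (vanish (Q d) (pow2 d)))) (go d ℕ.≤-refl)
      where
      Q : ℕ → ℤ
      Q k = Σ≤ k (λ k → κ k * (reversed d k * reversed d k))
      vanish : ∀ q p → q + + 3 * (p * 0ℤ) ≡ q
      vanish = solve-∀
      go : ∀ k → k ℕ.≤ d → Q k + + 3 * (pow2 k * S u (d ∸ k)) ≡ ψ u d * ψ u d + + 3 * S u d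
      go zero    _   = lemma (ψ u d * ψ u d) (S u d)
        where
        lemma : ∀ a s → 1ℤ * a + + 3 * (1ℤ * s) ≡ a + + 3 * s
        lemma = solve-∀
      go (suc k) k<d = trans (lemma (Q k) (pow2 k) (ψ u (d ∸ suc k) * ψ u (d ∸ suc k)) (S u (d ∸ suc k)))
        (trans (cong (λ i → Q k + + 3 * (pow2 k * S u i)) (sym (suc-∸ k<d))) (go k (ℕ.<⇒≤ k<d)))
        where
        lemma : ∀ q p a s → q + + 3 * p * a + + 3 * (+ 2 * p * s) ≡ q + + 3 * (p * (+ 2 * s + a))
        lemma = solve-∀

  -- At u = −3 the recursion for ψ u has the roots −1 and −2, whence the closed forms; for u = D − 3 with
  -- D = 2 ^ d they are expanded to first order in D, that is modulo D * D.
  module Expansion (D : ℤ) where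

    u : ℤ
    u = - + 3 + D

    σ : ℕ → ℤ
    σ zero    = 1ℤ
    σ (suc j) = - σ j

    σ-square : ∀ j → σ j * σ j ≡ 1ℤ
    σ-square zero    = refl
    σ-square (suc j) = trans (lemma (σ j)) (σ-square j)
      where
      lemma : ∀ s → - s * - s ≡ s * s
      lemma = solve-∀

    -- `- σ j * γ j` is the derivative of `ψ u j` with respect to `u` at -3.
    γ : ℕ → ℤ
    γ j = (+ 4 * + j - + 10) * pow2 j + + 3 * + j + + 10

    base : ℕ → ℤ
    base j = + 4 * pow2 j - + 3

    ψ-expansion : ∀ j → ψ u j ≈ σ j * (base j - D * γ j) [ D * D ]
    ψ-expansion zero = ≈-reflexive (lemma D)
      where
      lemma : ∀ D → 1ℤ ≡ 1ℤ * (+ 4 * 1ℤ - + 3 - D * ((+ 4 * 0ℤ - + 10) * 1ℤ + + 3 * 0ℤ + + 10))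
      lemma = solve-∀
    ψ-expansion (suc zero) = ≈-reflexive (lemma D)
      where
      lemma : ∀ D → - + 3 + D - + 2 ≡ - 1ℤ * (+ 4 * (+ 2 * 1ℤ) - + 3 - D * ((+ 4 * 1ℤ - + 10) * (+ 2 * 1ℤ) + + 3 * 1ℤ + + 10))
      lemma = solve-∀
    ψ-expansion (suc (suc j)) = ≈-trans (+-cong (*-congˡ u (ψ-expansion (suc j)))
        (≈-trans (≈-reflexive (ℤ.neg-distribˡ-* (+ 2) (ψ u j))) (*-congˡ (- + 2) (ψ-expansion j))))
      (mod (σ j * γ (suc j)) (lemma D (σ j) (+ j) (pow2 j)))
      where
      lemma : ∀ D s n p →
        (- + 3 + D) * (- s * (+ 4 * (+ 2 * p) - + 3 - D * ((+ 4 * (1ℤ + n) - + 10) * (+ 2 * p) + + 3 * (1ℤ + n) + + 10)))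
        + - + 2 * (s * (+ 4 * p - + 3 - D * ((+ 4 * n - + 10) * p + + 3 * n + + 10)))
        ≡ - - s * (+ 4 * (+ 2 * (+ 2 * p)) - + 3 - D * ((+ 4 * (+ 2 + n) - + 10) * (+ 2 * (+ 2 * p)) + + 3 * (+ 2 + n) + + 10))
        + s * ((+ 4 * (1ℤ + n) - + 10) * (+ 2 * p) + + 3 * (1ℤ + n) + + 10) * (D * D)
      lemma = solve-∀

    square-expansion : ∀ j → ψ u j * ψ u j ≈ base j * base j - + 2 * D * γ j * base j [ D * D ]
    square-expansion j = ≈-trans (*-cong (ψ-expansion j) (ψ-expansion j))
      (≈-trans (≈-reflexive (trans (regroup (σ j) (base j - D * γ j)) (cong (_* ((base j - D * γ j) * (base j - D * γ j))) (σ-square j))))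
        (mod (γ j * γ j) (lemma D (base j) (γ j))))
      where
      regroup : ∀ s b → s * b * (s * b) ≡ s * s * (b * b)
      regroup = solve-∀
      lemma : ∀ D b g → 1ℤ * ((b - D * g) * (b - D * g)) ≡ b * b - + 2 * D * g * b + g * g * (D * D)
      lemma = solve-∀

    S-expansion : ∀ j → S u j ≈ (+ 8 * (pow2 j * pow2 j) - + 12 * + j * pow2 j + pow2 j - + 9)
      - D * ((+ 16 * + j - + 72) * (pow2 j * pow2 j) + (+ 70 * + j - + 6) * pow2 j + + 18 * + j + + 78) [ D * D ]
    S-expansion zero = ≈-reflexive (lemma D)
      where
      lemma : ∀ D → 0ℤ ≡ (+ 8 * (1ℤ * 1ℤ) - + 12 * 0ℤ * 1ℤ + 1ℤ - + 9)
        - D * ((+ 16 * 0ℤ - + 72) * (1ℤ * 1ℤ) + (+ 70 * 0ℤ - + 6) * 1ℤ + + 18 * 0ℤ + + 78)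
      lemma = solve-∀
    S-expansion (suc j) = ≈-trans (+-cong (*-congˡ (+ 2) (S-expansion j)) (square-expansion j)) (≈-reflexive (lemma D (+ j) (pow2 j)))
      where
      lemma : ∀ D n p → + 2 * ((+ 8 * (p * p) - + 12 * n * p + p - + 9) - D * ((+ 16 * n - + 72) * (p * p) + (+ 70 * n - + 6) * p + + 18 * n + + 78))
        + ((+ 4 * p - + 3) * (+ 4 * p - + 3) - + 2 * D * ((+ 4 * n - + 10) * p + + 3 * n + + 10) * (+ 4 * p - + 3))
        ≡ (+ 8 * (+ 2 * p * (+ 2 * p)) - + 12 * (1ℤ + n) * (+ 2 * p) + + 2 * p - + 9)
        - D * ((+ 16 * (1ℤ + n) - + 72) * (+ 2 * p * (+ 2 * p)) + (+ 70 * (1ℤ + n) - + 6) * (+ 2 * p) + + 18 * (1ℤ + n) + + 78)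
      lemma = solve-∀

  module AtPower (e : ℕ) where

    p n D : ℤ
    p = pow2 e
    n = + e
    D = + 2 * p

    open Expansion (+ 2 * p)

    -- At -3 the left side is `-6 σ e D`, and its derivative there is `6 σ e` up to a multiple of
    -- `D`, so the Newton correction is exactly `D`.
    root : + 3 * ψ u e - u * ψ u (suc e) ≈ 0ℤ [ + 2 * p * (+ 2 * p) ]
    root = ≈-trans (+-cong (*-congˡ (+ 3) (ψ-expansion e)) (≈-trans (≈-reflexive (ℤ.neg-distribˡ-* u (ψ u (suc e)))) (*-congˡ (- u) (ψ-expansion (suc e)))))
      (mod (σ e * (+ 1 + + 6 * n - γ (suc e))) (lemma (σ e) n p))
      where
      lemma : ∀ s n p → + 3 * (s * (+ 4 * p - + 3 - + 2 * p * ((+ 4 * n - + 10) * p + + 3 * n + + 10)))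
        + - (- + 3 + + 2 * p) * (- s * (+ 4 * (+ 2 * p) - + 3 - + 2 * p * ((+ 4 * (1ℤ + n) - + 10) * (+ 2 * p) + + 3 * (1ℤ + n) + + 10)))
        ≡ 0ℤ + s * (+ 1 + + 6 * n - ((+ 4 * (1ℤ + n) - + 10) * (+ 2 * p) + + 3 * (1ℤ + n) + + 10)) * (+ 2 * p * (+ 2 * p))
      lemma = solve-∀

    -- Up to sign, the coefficients of `D` in `T` and in `(3 D - 2) ψ²`, where `3 D - 2` is the
    -- order of the graph. The constant terms are both -18, which is why the multiplicity comes out
    -- as 1 modulo `p`.
    c c′ : ℤ
    c  = + 72 * n + + 267
    c′ = + 36 * n + + 81

    order-expansion : (+ 3 * (+ 2 * p) - + 2) * (ψ u (suc e) * ψ u (suc e)) ≈ - (+ 18 + + 2 * p * c′) [ + 2 * p * (+ 2 * p) ]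
    order-expansion = ≈-trans (*-congˡ (+ 3 * (+ 2 * p) - + 2) (square-expansion (suc e)))
      (mod (+ 410 + + 54 * n + (+ 64 * n - + 468) * D + (+ 144 - + 96 * n) * (D * D)) (lemma n D))
      where
      lemma : ∀ n D → (+ 3 * D - + 2) * ((+ 4 * D - + 3) * (+ 4 * D - + 3)
          - + 2 * D * ((+ 4 * (1ℤ + n) - + 10) * D + + 3 * (1ℤ + n) + + 10) * (+ 4 * D - + 3))
        ≡ - (+ 18 + D * (+ 36 * n + + 81))
        + (+ 410 + + 54 * n + (+ 64 * n - + 468) * D + (+ 144 - + 96 * n) * (D * D)) * (D * D)
      lemma = solve-∀

    T : ℤ
    T = ψ u (suc e) * ψ u (suc e) + + 3 * S u (suc e)

    T-expansion : T ≈ - (+ 18 + + 2 * p * c) [ + 2 * p * (+ 2 * p) ]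
    T-expansion = ≈-trans (+-cong (square-expansion (suc e)) (*-congˡ (+ 3) (S-expansion (suc e))))
      (mod (- + 292 - + 210 * n + (+ 216 - + 80 * n) * D) (lemma n D))
      where
      lemma : ∀ n D → (+ 4 * D - + 3) * (+ 4 * D - + 3)
          - + 2 * D * ((+ 4 * (1ℤ + n) - + 10) * D + + 3 * (1ℤ + n) + + 10) * (+ 4 * D - + 3)
          + + 3 * ((+ 8 * (D * D) - + 12 * (1ℤ + n) * D + D - + 9)
            - D * ((+ 16 * (1ℤ + n) - + 72) * (D * D) + (+ 70 * (1ℤ + n) - + 6) * D + + 18 * (1ℤ + n) + + 78))
        ≡ - (+ 18 + D * (+ 72 * n + + 267)) + (- + 292 - + 210 * n + (+ 216 - + 80 * n) * D) * (D * D)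
      lemma = solve-∀

  -- The interface between graphs and arithmetic: the conclusion of `Moore.multiplicity` in terms of
  -- `d = suc e` and the order `n` alone.
  Multiplicity : ℕ → ℕ → Set
  Multiplicity e n = ∀ u → Odd u → ∀ K s → + 3 * ψ u e - u * ψ u (suc e) ≈ 0ℤ [ pow2 (3 ℕ.+ K) ] →
    ψ u (suc e) * ψ u (suc e) + + 3 * S u (suc e) ≡ + 2 * s → Odd s →
    ∃ λ r → r ℕ.≤ suc n × + n * (ψ u (suc e) * ψ u (suc e)) ≈ + r * (+ 2 * s) [ pow2 (2 ℕ.+ K) ]

  -- Arithmetic that excludes every multiplicity for `d ≥ 3`

  pow2-+ : ∀ a b → pow2 (a ℕ.+ b) ≡ pow2 a * pow2 b
  pow2-+ zero    b = sym (ℤ.*-identityˡ (pow2 b))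
  pow2-+ (suc a) b = trans (cong (+ 2 *_) (pow2-+ a b)) (sym (ℤ.*-assoc (+ 2) (pow2 a) (pow2 b)))

  pow2≡ : ∀ k → pow2 k ≡ + (2 ℕ.^ k)
  pow2≡ zero    = refl
  pow2≡ (suc k) = trans (cong (+ 2 *_) (pow2≡ k)) (sym (ℤ.pos-* 2 (2 ℕ.^ k)))

  odd-cancel : ∀ {a} → Odd a → ∀ k b → a * b ≈ 0ℤ [ pow2 k ] → b ≈ 0ℤ [ pow2 k ]
  odd-cancel {a} odd k b ab≈0 with odd-invertible odd k
  ... | x , ax≈1 = ≈-trans (≈-sym (≈-trans (*-congʳ b ax≈1) (≈-reflexive (ℤ.*-identityˡ b))))
    (≈-trans (≈-reflexive (lemma a x b)) (≈-trans (*-congˡ x ab≈0) (≈-reflexive (ℤ.*-zeroʳ x))))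
    where
    lemma : ∀ a x b → a * x * b ≡ x * (a * b)
    lemma = solve-∀

  ≈0⇒∣ : ∀ {a} k → + a ≈ 0ℤ [ pow2 k ] → 2 ℕ.^ k ℕ∣.∣ a
  ≈0⇒∣ {a} k (mod q eq) = ∣⇒∣ᵤ (divides q (trans eq (trans (ℤ.+-identityˡ _) (cong (q *_) (pow2≡ k)))))

  -- With r = 1 + t p, the congruence for the multiplicity r, divided by 2 p, leaves one for t.
  module Large (e e₁ K n : ℕ) (e≡ : e ≡ suc e₁) (K≡ : 2 ℕ.+ K ≡ suc (e ℕ.+ e))
    (order : + n ≡ + 3 * pow2 (suc e) - + 2) (mult : Multiplicity e n) where

    open AtPower e using (p; c; c′; T; root; order-expansion; T-expansion)
    open Expansion (+ 2 * p) using (u)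

    M : ℤ
    M = pow2 (2 ℕ.+ K)

    M≡ : M ≡ + 2 * (p * p)
    M≡ = trans (cong pow2 K≡) (cong (+ 2 *_) (pow2-+ e e))

    4pp≡ : + 2 * p * (+ 2 * p) ≡ pow2 (3 ℕ.+ K)
    4pp≡ = trans (lemma p) (cong (+ 2 *_) (sym M≡))
      where
      lemma : ∀ p → + 2 * p * (+ 2 * p) ≡ + 2 * (+ 2 * (p * p))
      lemma = solve-∀

    u-odd : Odd u
    u-odd = p - + 2 , lemma p
      where
      lemma : ∀ p → - + 3 + + 2 * p ≡ 1ℤ + + 2 * (p - + 2)
      lemma = solve-∀

    p₁ q s : ℤ
    p₁ = pow2 e₁
    q  = _≈_[_].quot T-expansion
    s  = - + 9 - p * c + + 2 * (q * (p * p))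

    p≡ : p ≡ + 2 * p₁
    p≡ = cong pow2 e≡

    T≡2s : T ≡ + 2 * s
    T≡2s = trans (_≈_[_].eq T-expansion) (lemma p c q)
      where
      lemma : ∀ p c q → - (+ 18 + + 2 * p * c) + q * (+ 2 * p * (+ 2 * p)) ≡ + 2 * (- + 9 - p * c + + 2 * (q * (p * p)))
      lemma = solve-∀

    s-odd : Odd s
    s-odd = - + 5 - p₁ * c + q * (p * p) , trans (cong (λ a → - + 9 - a * c + + 2 * (q * (p * p))) p≡) (lemma p₁ c (q * (p * p)))
      where
      lemma : ∀ p c q → - + 9 - + 2 * p * c + + 2 * q ≡ 1ℤ + + 2 * (- + 5 - p * c + q)
      lemma = solve-∀

    solution : ∃ λ r → r ℕ.≤ suc n × + n * (ψ u (suc e) * ψ u (suc e)) ≈ + r * (+ 2 * s) [ M ]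
    solution = mult u u-odd K s (subst (λ m → + 3 * ψ u e - u * ψ u (suc e) ≈ 0ℤ [ m ]) 4pp≡ root) T≡2s s-odd

    r : ℕ
    r = proj₁ solution

    toM : ∀ {a b} → a ≈ b [ + 2 * p * (+ 2 * p) ] → a ≈ b [ M ]
    toM {a} {b} a≈b = ≈-weaken (+ 2) (subst (λ m → a ≈ b [ m ]) 4pp≡ a≈b)

    congruence : + r * (+ 18 + + 2 * p * c) ≈ + 18 + + 2 * p * c′ [ + 2 * (p * p) ]
    congruence = subst (λ m → + r * (+ 18 + + 2 * p * c) ≈ + 18 + + 2 * p * c′ [ m ]) M≡
      (≈-trans (≈-reflexive (flip (+ r) (+ 18 + + 2 * p * c))) (≈-trans (*-congˡ (- 1ℤ) both) (≈-reflexive (flip′ (+ 18 + + 2 * p * c′)))))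
      where
      flip : ∀ r b → r * b ≡ - 1ℤ * (r * - b)
      flip = solve-∀
      flip′ : ∀ b → - 1ℤ * - b ≡ b
      flip′ = solve-∀
      ψ² = ψ u (suc e) * ψ u (suc e)
      both : + r * - (+ 18 + + 2 * p * c) ≈ - (+ 18 + + 2 * p * c′) [ M ]
      both = ≈-trans (*-congˡ (+ r) (≈-trans (≈-sym (toM T-expansion)) (≈-reflexive T≡2s)))
        (≈-trans (≈-sym (proj₂ (proj₂ solution))) (≈-trans (≈-reflexive (cong (_* ψ²) order)) (toM order-expansion)))

    q₁ : ℤ
    q₁ = _≈_[_].quot congruence

    halved : + 9 * (+ r - 1ℤ) ≡ (c′ - + r * c + q₁ * p) * p
    halved = ℤ.*-cancelˡ-≡ (+ 2) (+ 9 * (+ r - 1ℤ)) ((c′ - + r * c + q₁ * p) * p)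
      (trans (lemma₁ (+ r) p c) (trans (cong (λ a → a - + 18 - + 2 * p * (+ r * c)) (_≈_[_].eq congruence)) (lemma₂ (+ r) p c c′ q₁)))
      where
      lemma₁ : ∀ r p c → + 2 * (+ 9 * (r - 1ℤ)) ≡ r * (+ 18 + + 2 * p * c) - + 18 - + 2 * p * (r * c)
      lemma₁ = solve-∀
      lemma₂ : ∀ r p c c′ q → + 18 + + 2 * p * c′ + q * (+ 2 * (p * p)) - + 18 - + 2 * p * (r * c) ≡ + 2 * ((c′ - r * c + q * p) * p)
      lemma₂ = solve-∀

    r-1≈0 : + r - 1ℤ ≈ 0ℤ [ p ]
    r-1≈0 = odd-cancel (+ 4 , refl) e (+ r - 1ℤ) (mod (c′ - + r * c + q₁ * p) (trans halved (sym (ℤ.+-identityˡ _))))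

    n+2≡ : n ℕ.+ 2 ≡ 6 ℕ.* 2 ℕ.^ e
    n+2≡ = ℤ.+-injective (trans (cong (_+ + 2) (trans order (cong (λ p → + 3 * (+ 2 * p) - + 2) (pow2≡ e))))
      (trans (lemma (+ (2 ℕ.^ e))) (sym (ℤ.pos-* 6 (2 ℕ.^ e)))))
      where
      lemma : ∀ p → + 3 * (+ 2 * p) - + 2 + + 2 ≡ + 6 * p
      lemma = solve-∀

    -- The bound on `t` comes from `t p = r - 1 ≤ n < n + 2 = 6 p`.
    quotient : ∀ r → r ℕ.≤ suc n → + r - 1ℤ ≈ 0ℤ [ p ] → ∃ λ t → t ℕ.< 6 × + r ≡ 1ℤ + + t * p
    -- For `r = 0` the power `2 ^ e` would divide 1, although `e` is positive.
    quotient zero _ -1≈0 = contradiction (sym (ℕ∣.∣1⇒≡1 (≈0⇒∣ {1} e (*-congˡ (- 1ℤ) -1≈0)))) (ℕ.<⇒≢ (ℕ.^-monoʳ-≤ 2 {1} {e} (subst (1 ℕ.≤_) (sym e≡) (s≤s z≤n))))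
    quotient (suc r′) (s≤s r′≤n) r′≈0 with ≈0⇒∣ {r′} e (≈-trans (≈-reflexive (sym (lemma (+ r′)))) r′≈0)
      where
      lemma : ∀ a → 1ℤ + a - 1ℤ ≡ a
      lemma = solve-∀
    ... | ℕ∣.divides t eq = t , ℕ.*-cancelʳ-< (2 ℕ.^ e) t 6 (ℕ.≤-trans (s≤s (ℕ.≤-trans (ℕ.≤-reflexive (sym eq)) r′≤n))
        (ℕ.≤-trans (ℕ.≤-reflexive (ℕ.+-comm 1 n)) (ℕ.≤-trans (ℕ.+-monoʳ-≤ n (s≤s z≤n)) (ℕ.≤-reflexive n+2≡))))
      , cong (λ a → 1ℤ + a) (trans (cong +_ eq) (trans (ℤ.pos-* t (2 ℕ.^ e)) (cong (+ t *_) (sym (pow2≡ e)))))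

    module _ (t : ℕ) (r≡ : + r ≡ 1ℤ + + t * p) where

      X : ℤ
      X = + 3 * + t + + 12 * + e + + 62

      X≡ : + (3 ℕ.* t ℕ.+ 12 ℕ.* e ℕ.+ 62) ≡ X
      X≡ = trans (ℤ.pos-+ (3 ℕ.* t ℕ.+ 12 ℕ.* e) 62) (cong (_+ + 62)
        (trans (ℤ.pos-+ (3 ℕ.* t) (12 ℕ.* e)) (cong₂ _+_ (ℤ.pos-* 3 t) (ℤ.pos-* 12 e))))

      cancelled : + 9 * + t ≡ c′ - (1ℤ + + t * p) * c + q₁ * p
      cancelled = ℤ.*-cancelʳ-≡ (+ 9 * + t) (c′ - (1ℤ + + t * p) * c + q₁ * p) p
        {{subst NonZero (sym (pow2≡ e)) (ℕ.m^n≢0 2 e)}}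
        (trans (lemma (+ t) p) (trans (cong (λ a → + 9 * (a - 1ℤ)) (sym r≡)) (trans halved (cong (λ a → (c′ - a * c + q₁ * p) * p) r≡))))
        where
        lemma : ∀ t p → + 9 * t * p ≡ + 9 * (1ℤ + t * p - 1ℤ)
        lemma = solve-∀

      -- `c - c′` is `36 e + 186`, three times `12 e + 62`, and `t p c` is absorbed into the
      -- multiple of `p`.
      reduced : + 3 * X ≡ 0ℤ + (q₁ - + t * c) * p
      reduced = trans (lemma₁ (+ t) (+ e)) (trans (cong (λ a → a + c - c′) cancelled) (lemma₂ (+ t) c c′ q₁ p))
        where
        lemma₁ : ∀ t e → + 3 * (+ 3 * t + + 12 * e + + 62) ≡ + 9 * t + (+ 72 * e + + 267) - (+ 36 * e + + 81)
        lemma₁ = solve-∀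
        lemma₂ : ∀ t c c′ q p → c′ - (1ℤ + t * p) * c + q * p + c - c′ ≡ 0ℤ + (q - t * c) * p
        lemma₂ = solve-∀

      X-divisible : 2 ℕ.^ e ℕ∣.∣ 3 ℕ.* t ℕ.+ 12 ℕ.* e ℕ.+ 62
      X-divisible = ≈0⇒∣ e (≈-trans (≈-reflexive X≡) (odd-cancel {+ 3} (+ 1 , refl) e X (mod (q₁ - + t * c) reduced)))

    divisibility : ∃ λ t → t ℕ.< 6 × 2 ℕ.^ e ℕ∣.∣ 3 ℕ.* t ℕ.+ 12 ℕ.* e ℕ.+ 62
    divisibility = proj₁ t , proj₁ (proj₂ t) , X-divisible (proj₁ t) (proj₂ (proj₂ t))
      where
      t : ∃ λ t → t ℕ.< 6 × + r ≡ 1ℤ + + t * p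
      t = quotient r (proj₁ (proj₂ solution)) r-1≈0

  -- Here 78 is `62 + 3 · 5 + 1`: the largest value `t = 5`, and one more to make the inequality in
  -- `too-large` strict.
  growth : ∀ k → 12 ℕ.* (8 ℕ.+ k) ℕ.+ 78 ℕ.≤ 2 ℕ.^ (8 ℕ.+ k)
  growth zero    = ℕ.≤ᵇ⇒≤ _ _ _
  growth (suc k) = begin
    12 ℕ.* (9 ℕ.+ k) ℕ.+ 78            ≡⟨ cong (ℕ._+ 78) (ℕ.*-suc 12 (8 ℕ.+ k)) ⟩
    12 ℕ.+ 12 ℕ.* (8 ℕ.+ k) ℕ.+ 78     ≡⟨ ℕ.+-assoc 12 (12 ℕ.* (8 ℕ.+ k)) 78 ⟩
    12 ℕ.+ (12 ℕ.* (8 ℕ.+ k) ℕ.+ 78)   ≤⟨ ℕ.+-mono-≤ (ℕ.≤-trans (ℕ.≤ᵇ⇒≤ 12 256 _) (ℕ.^-monoʳ-≤ 2 {8} (ℕ.m≤m+n 8 k))) (growth k) ⟩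
    2 ℕ.^ (8 ℕ.+ k) ℕ.+ 2 ℕ.^ (8 ℕ.+ k) ≡⟨ cong (2 ℕ.^ (8 ℕ.+ k) ℕ.+_) (ℕ.+-identityʳ _) ⟨
    2 ℕ.^ (9 ℕ.+ k)                     ∎
    where open ℕ.≤-Reasoning

  too-large : ∀ k → ¬ ∃ λ t → t ℕ.< 6 × 2 ℕ.^ (8 ℕ.+ k) ℕ∣.∣ 3 ℕ.* t ℕ.+ 12 ℕ.* (8 ℕ.+ k) ℕ.+ 62
  too-large k (t , s≤s t≤5 , div) = ℕ.<⇒≱ small (ℕ∣.∣⇒≤ {{ℕ.>-nonZero (ℕ.≤-trans (s≤s z≤n) (ℕ.m≤n+m 62 (3 ℕ.* t ℕ.+ 12 ℕ.* (8 ℕ.+ k))))}} div)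
    where
    open ℕ.≤-Reasoning
    small : 3 ℕ.* t ℕ.+ 12 ℕ.* (8 ℕ.+ k) ℕ.+ 62 ℕ.< 2 ℕ.^ (8 ℕ.+ k)
    small = begin-strict
      3 ℕ.* t ℕ.+ 12 ℕ.* (8 ℕ.+ k) ℕ.+ 62 ≤⟨ ℕ.+-monoˡ-≤ 62 (ℕ.+-monoˡ-≤ (12 ℕ.* (8 ℕ.+ k)) (ℕ.*-monoʳ-≤ 3 t≤5)) ⟩
      15 ℕ.+ 12 ℕ.* (8 ℕ.+ k) ℕ.+ 62      ≡⟨ cong (ℕ._+ 62) (ℕ.+-comm 15 (12 ℕ.* (8 ℕ.+ k))) ⟩
      12 ℕ.* (8 ℕ.+ k) ℕ.+ 15 ℕ.+ 62      ≡⟨ ℕ.+-assoc (12 ℕ.* (8 ℕ.+ k)) 15 62 ⟩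
      12 ℕ.* (8 ℕ.+ k) ℕ.+ 77             <⟨ ℕ.+-monoʳ-< (12 ℕ.* (8 ℕ.+ k)) (ℕ.n<1+n 77) ⟩
      12 ℕ.* (8 ℕ.+ k) ℕ.+ 78             ≤⟨ growth k ⟩
      2 ℕ.^ (8 ℕ.+ k)                     ∎

  ≈⇒∣- : ∀ {a b m} → a ≈ b [ m ] → m ∣ a - b
  ≈⇒∣- {b = b} {m} (mod q refl) = divides q (lemma b q m)
    where
    lemma : ∀ b q m → b + q * m - b ≡ q * m
    lemma = solve-∀

  no-multiplicity : ∀ e n u K s → + 3 * ψ u e - u * ψ u (suc e) ≈ 0ℤ [ pow2 (3 ℕ.+ K) ] → Odd u →
    ψ u (suc e) * ψ u (suc e) + + 3 * S u (suc e) ≡ + 2 * s → Odd s →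
    (∀ {r} → r ℕ.< 2 ℕ.+ n → ¬ pow2 (2 ℕ.+ K) ∣ + n * (ψ u (suc e) * ψ u (suc e)) - + r * (+ 2 * s)) →
    ¬ Multiplicity e n
  no-multiplicity e n u K s root odd T≡ s-odd none mult with mult u odd K s root T≡ s-odd
  ... | r , r≤ , r-solves = none (s≤s r≤) (≈⇒∣- r-solves)

  solution? : ∀ m a b N → Dec (∀ {r} → r ℕ.< N → ¬ m ∣ a - + r * b)
  solution? m a b N = ℕ.allUpTo? (λ r → ¬? (m ∣? (a - + r * b))) N

  NoQuotient : ℕ → Set
  NoQuotient e = ∀ {t} → t ℕ.< 6 → ¬ 2 ℕ.^ e ℕ∣.∣ 3 ℕ.* t ℕ.+ 12 ℕ.* e ℕ.+ 62

  noQuotient? : ∀ e → Dec (NoQuotient e)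
  noQuotient? e = ℕ.allUpTo? (λ t → ¬? (2 ℕ.^ e ℕ∣.∣? 3 ℕ.* t ℕ.+ 12 ℕ.* e ℕ.+ 62)) 6

  no-multiplicity-large : ∀ e e₁ n → e ≡ suc e₁ → + n ≡ + 3 * pow2 (suc e) - + 2 → NoQuotient e → ¬ Multiplicity e n
  no-multiplicity-large e e₁ n e≡ order none mult = none (proj₁ (proj₂ t)) (proj₂ (proj₂ t))
    where
    t : ∃ λ t → t ℕ.< 6 × 2 ℕ.^ e ℕ∣.∣ 3 ℕ.* t ℕ.+ 12 ℕ.* e ℕ.+ 62
    t = Large.divisibility e e₁ (e₁ ℕ.+ e) n e≡ (cong (λ a → suc (a ℕ.+ e)) (sym e≡)) order mult

  -- For d = suc e = 3, 4, 6 the bound modulo 2 ^ (2 d) leaves a solution, but u = −3 + 2 ^ d is a root to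
  -- the higher precision 2 ^ 7, 2 ^ 9, 2 ^ 15, which rules it out.
  no-moore-multiplicity : ∀ e n → 2 ℕ.≤ e → + n ≡ + 3 * pow2 (suc e) - + 2 → ¬ Multiplicity e n
  no-moore-multiplicity 0 _ () _
  no-moore-multiplicity 1 _ (s≤s ()) _
  no-moore-multiplicity 2 n _ order with ℤ.+-injective {n} {22} order
  -- `+ 5` is `-3 + 2 ^ 3`, `4` stands for the modulus `2 ^ 7`, `+ 2027` is half of `T`, and
  -- `-[1+ 1 ]` says that the expression vanishing at a root equals `-2 · 2 ^ 7`. The search covers
  -- all `r` below `24 = n + 2`. The cases below follow the same pattern.
  ... | refl = no-multiplicity 2 22 (+ 5) 4 (+ 2027) (mod -[1+ 1 ] refl) (+ 2 , refl) refl (+ 1013 , refl)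
    (toWitness {a? = solution? (pow2 6) (+ 22 * (ψ (+ 5) 3 * ψ (+ 5) 3)) (+ 2 * + 2027) 24} _)
  no-moore-multiplicity 3 n _ order with ℤ.+-injective {n} {46} order
  ... | refl = no-multiplicity 3 46 (+ 13) 6 (+ 275517023) (mod -[1+ 579 ] refl) (+ 6 , refl) refl (+ 137758511 , refl)
    (toWitness {a? = solution? (pow2 8) (+ 46 * (ψ (+ 13) 4 * ψ (+ 13) 4)) (+ 2 * + 275517023) 48} _)
  no-moore-multiplicity 4 n _ order = no-multiplicity-large 4 3 n refl order (toWitness {a? = noQuotient? 4} _)
  no-moore-multiplicity 5 n _ order with ℤ.+-injective {n} {190} order
  ... | refl = no-multiplicity 5 190 (+ 61) 12 (+ 1235865419392887703959) (mod -[1+ 92438891 ] refl) (+ 30 , refl) refl (+ 617932709696443851979 , refl)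
    (toWitness {a? = solution? (pow2 14) (+ 190 * (ψ (+ 61) 6 * ψ (+ 61) 6)) (+ 2 * + 1235865419392887703959) 192} _)
  no-moore-multiplicity 6 n _ order = no-multiplicity-large 6 5 n refl order (toWitness {a? = noQuotient? 6} _)
  no-moore-multiplicity 7 n _ order = no-multiplicity-large 7 6 n refl order (toWitness {a? = noQuotient? 7} _)
  no-moore-multiplicity (suc (suc (suc (suc (suc (suc (suc (suc k)))))))) n _ order =
    no-multiplicity-large (8 ℕ.+ k) (7 ℕ.+ k) n refl order (λ t<6 div → too-large k (_ , t<6 , div))

-- Counting walks, and the graphs with d = 1, 2

module _ where

  open import Data.Nat as ℕ using (ℕ; zero; suc; z≤n; s≤s)
  open import Data.Integer using (ℤ; +_; _+_; _*_; _-_; -_; 0ℤ; 1ℤ)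
  import Data.Integer.Properties as ℤ
  open import Data.Integer.Tactic.RingSolver using (solve-∀)
  open import Data.Bool as Bool using (Bool; true; false; T; not; _∨_; if_then_else_)
  open import Data.Bool.Properties using (T-∧; T-≡)
  open import Data.Fin using (zero; suc; _≟_; splitAt; join)
  open import Data.Fin.Patterns using (0F; 1F; 2F; 3F; 4F)
  import Data.Fin.Properties as Fin
  open import Data.List using (length; filterᵇ; tabulate; allFin)
  import Data.List.Properties as List
  import Data.List.Membership.Propositional.Properties as ∈
  open import Data.List.Relation.Binary.Permutation.Propositional.Properties using (∈-resp-↭)
  open import Data.List.Relation.Unary.All using ([]; _∷_)
  open import Data.List.Relation.Unary.AllPairs using ([]; _∷_)
  open import Data.List.Relation.Unary.Any using (here; there)
  import Data.List.Relation.Unary.Unique.Propositional.Properties as Unique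
  open import Function.Construct.Identity using (↔-id)
  open import Algebra.Properties.AbelianGroup ℤ.+-0-abelianGroup using (∙-cancelˡ)
  open import Algebra.Properties.Semiring.Sum ℤ.+-*-semiring
    using (sum; sum-cong-≗; ∑-distrib-+; ∑-comm; *-distribˡ-sum; *-distribʳ-sum)

  Σ≤-zero : ∀ k {f : ℕ → ℤ} → (∀ j → j ℕ.≤ k → f j ≡ 0ℤ) → Σ≤ k f ≡ 0ℤ
  Σ≤-zero zero    p = p 0 z≤n
  Σ≤-zero (suc k) p = cong₂ _+_ (Σ≤-zero k (λ j j≤k → p j (ℕ.m≤n⇒m≤1+n j≤k))) (p (suc k) ℕ.≤-refl)

  Σ≤-single : ∀ k {f : ℕ → ℤ} i → i ℕ.≤ k → (∀ j → j ℕ.≤ k → j ≢ i → f j ≡ 0ℤ) → Σ≤ k f ≡ f i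
  Σ≤-single zero    zero _ _ = refl
  Σ≤-single (suc k) {f} i i≤k p with i ℕ.≟ suc k
  ... | yes refl = trans (cong (_+ f i) (Σ≤-zero k (λ j j≤k → p j (ℕ.m≤n⇒m≤1+n j≤k) (ℕ.<⇒≢ (s≤s j≤k))))) (ℤ.+-identityˡ _)
  ... | no i≢k   = trans (cong₂ _+_ (Σ≤-single k i (ℕ.≤-pred (ℕ.≤∧≢⇒< i≤k i≢k)) (λ j j≤k → p j (ℕ.m≤n⇒m≤1+n j≤k))) (p (suc k) ℕ.≤-refl (≢-sym i≢k))) (ℤ.+-identityʳ _)

  Σκ : ∀ d → Σ≤ d κ ≡ + 3 * pow2 d - + 2
  Σκ zero    = refl
  Σκ (suc d) = trans (cong (_+ + 3 * pow2 d) (Σκ d)) (lemma (pow2 d))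
    where
    lemma : ∀ p → + 3 * p - + 2 + + 3 * p ≡ + 3 * (+ 2 * p) - + 2
    lemma = solve-∀

  indicator : Bool → ℤ
  indicator b = if b then 1ℤ else 0ℤ

  sum-indicator : ∀ {X : Set} {n} (p : X → Bool) (g : Fin n → X) →
                  sum (λ i → indicator (p (g i))) ≡ + length (filterᵇ p (tabulate g))
  sum-indicator {n = zero}  p g = refl
  sum-indicator {n = suc n} p g with p (g zero)
  ... | true  = cong (λ t → 1ℤ + t) (sum-indicator p (λ i → g (suc i)))
  ... | false = trans (ℤ.+-identityˡ _) (sum-indicator p (λ i → g (suc i)))

  sum-*δ : ∀ {n} (f : Fin n → ℤ) i → sum (λ j → f j * δ j i) ≡ f i
  sum-*δ f i = trans (sum-single i (λ j j≢i → trans (cong (f j *_) (δ-≢ j≢i)) (ℤ.*-zeroʳ (f j))))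
    (trans (cong (f i *_) (δ-refl i)) (ℤ.*-identityʳ _))

  -- Counting matrices of nonbacktracking walks

  module WalkCount {n : ℕ} (Γ : Graph n) (cubic : ∀ v → degree Γ v ≡ 3) where

    A : Matrix n
    A x y = indicator (adj Γ x y)

    -- W k p v t counts the walks of length k from v to t with first step other than to p.
    W : ℕ → Fin n → Matrix n
    W zero    p v t = δ v t
    W (suc k) p v t = sum (λ w → A v w * (1ℤ - δ w p) * W k v w t)

    N : ℕ → Matrix n
    N zero    = δ
    N (suc k) x t = sum (λ w → A x w * W k x w t)

    A-row : ∀ x → sum (A x) ≡ + 3
    A-row x = trans (sum-indicator (adj Γ x) (λ i → i)) (cong +_ (cubic x))

    A-square : ∀ x w c → A x w * (A w x * c) ≡ A x w * c
    A-square x w c rewrite adj-sym Γ w x with adj Γ x w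
    ... | true  = cong (1ℤ *_) (ℤ.*-identityˡ c)
    ... | false = refl

    W-split : ∀ k x w t → sum (λ v → A w v * W k w v t) ≡ W (suc k) x w t + A w x * W k w x t
    W-split k x w t = trans (sum-cong-≗ (λ v → lemma (A w v) (δ v x) (W k w v t)))
      (trans (∑-distrib-+ (λ v → A w v * (1ℤ - δ v x) * W k w v t) (λ v → A w v * W k w v t * δ v x))
        (cong (λ s → W (suc k) x w t + s) (sum-*δ (λ v → A w v * W k w v t) x)))
      where
      lemma : ∀ a e c → a * c ≡ a * (1ℤ - e) * c + a * c * e
      lemma = solve-∀

    -- After a step from `x` to `w`, a walk out of `w` either does not return to `x` at once, which
    -- gives `N (2 + k)`, or does, which leaves a walk out of `x` avoiding `w`.
    A⊗N : ∀ k x t → (A ⊗ N (suc k)) x t ≡ N (2 ℕ.+ k) x t + sum (λ w → A x w * W k w x t)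
    A⊗N k x t = trans (sum-cong-≗ (λ w → trans (cong (A x w *_) (W-split k x w t))
        (trans (ℤ.*-distribˡ-+ (A x w) _ _) (cong (λ s → A x w * W (suc k) x w t + s) (A-square x w (W k w x t))))))
      (∑-distrib-+ (λ w → A x w * W (suc k) x w t) (λ w → A x w * W k w x t))

    AN₁ : ∀ x t → (A ⊗ N 1) x t ≡ N 2 x t + + 3 * N 0 x t
    AN₁ x t = trans (A⊗N 0 x t) (cong (λ s → N 2 x t + s)
      (trans (sym (*-distribʳ-sum (δ x t) (A x))) (cong (_* δ x t) (A-row x))))

    AN : ∀ k x t → (A ⊗ N (2 ℕ.+ k)) x t ≡ N (3 ℕ.+ k) x t + + 2 * N (1 ℕ.+ k) x t
    AN k x t = trans (A⊗N (suc k) x t) (cong (λ s → N (3 ℕ.+ k) x t + s) revisit)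
      where
      N₁ = N (suc k) x t
      term : ∀ w → A x w * W (suc k) w x t ≡ A x w * N₁ + - 1ℤ * (A x w * W k x w t)
      term w with W-split k w x t
      ... | split = trans (cong (A x w *_) (shift N₁ (W (suc k) w x t) (A x w * W k x w t) split))
        (trans (spread (A x w) N₁ (A x w * W k x w t)) (cong (λ s → A x w * N₁ + - 1ℤ * s) (square x w (W k x w t))))
        where
        shift : ∀ a b c → a ≡ b + c → b ≡ a - c
        shift a b c refl = lemma b c
          where
          lemma : ∀ b c → b ≡ b + c - c
          lemma = solve-∀
        spread : ∀ a n c → a * (n - c) ≡ a * n + - 1ℤ * (a * c)
        spread = solve-∀
        square : ∀ x w c → A x w * (A x w * c) ≡ A x w * c
        square x w c = trans (cong (λ b → A x w * (indicator b * c)) (adj-sym Γ x w)) (A-square x w c)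
      -- A walk out of `x` is counted once for each neighbour of `x` other than its first step:
      -- `3 N₁ - N₁`.
      revisit : sum (λ w → A x w * W (suc k) w x t) ≡ + 2 * N₁
      revisit = trans (sum-cong-≗ term) (trans (sum-linear (λ w → A x w * N₁) (λ w → A x w * W k x w t) (- 1ℤ))
        (trans (cong (_+ - 1ℤ * N₁) (trans (sym (*-distribʳ-sum N₁ (A x))) (cong (_* N₁) (A-row x)))) (lemma N₁)))
        where
        lemma : ∀ a → + 3 * a + - 1ℤ * a ≡ + 2 * a
        lemma = solve-∀

    ⊗-row : ∀ (E F : Matrix n) c → (∀ i → sum (F i) ≡ c) → ∀ x → sum ((E ⊗ F) x) ≡ sum (E x) * c
    ⊗-row E F c rows x = trans (∑-comm (λ j k → E x k * F k j)) (trans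
      (sum-cong-≗ (λ k → trans (sym (*-distribˡ-sum (E x k) (F k))) (cong (E x k *_) (rows k)))) (sym (*-distribʳ-sum c (E x))))

    subtract : ∀ a b c → a ≡ b + c → b ≡ a - c
    subtract a b c refl = lemma b c
      where
      lemma : ∀ b c → b ≡ b + c - c
      lemma = solve-∀

    N-row-next : ∀ k c → (∀ x t → (A ⊗ N (suc k)) x t ≡ N (2 ℕ.+ k) x t + c * N k x t) → c * κ k ≡ κ (suc k) →
      (∀ x → sum (N k x) ≡ κ k) → (∀ x → sum (N (suc k) x) ≡ κ (suc k)) → ∀ x → sum (N (2 ℕ.+ k) x) ≡ κ (2 ℕ.+ k)
    N-row-next k c rec cκ row₀ row₁ x = trans (subtract (+ 3 * κ (suc k)) (sum (N (2 ℕ.+ k) x)) (κ (suc k)) both) (shape (pow2 k))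
      where
      shape : ∀ p → + 3 * (+ 3 * p) - + 3 * p ≡ + 3 * (+ 2 * p)
      shape = solve-∀
      both : + 3 * κ (suc k) ≡ sum (N (2 ℕ.+ k) x) + κ (suc k)
      both = trans (cong (_* κ (suc k)) (sym (A-row x))) (trans (sym (⊗-row A (N (suc k)) (κ (suc k)) row₁ x))
        (trans (sum-cong-≗ (rec x)) (trans (sum-linear (N (2 ℕ.+ k) x) (N k x) c)
        (cong (λ s → sum (N (2 ℕ.+ k) x) + s) (trans (cong (c *_) (row₀ x)) cκ)))))

    N-row : ∀ k x → sum (N k x) ≡ κ k
    N-row zero    x = trans (sum-single x (λ y y≢x → δ-≢ (≢-sym y≢x))) (δ-refl x)
    N-row (suc zero) x = trans (sum-cong-≗ (λ t → sum-*δ (A x) t)) (A-row x)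
    N-row (suc (suc zero)) = N-row-next 0 (+ 3) AN₁ refl (N-row 0) (N-row 1)
    N-row (suc (suc (suc k))) = N-row-next (suc k) (+ 2) (AN k) (double (pow2 k)) (N-row (suc k)) (N-row (suc (suc k)))
      where
      double : ∀ p → + 2 * (+ 3 * p) ≡ + 3 * (+ 2 * p)
      double = solve-∀

    A⊗Σ : ∀ k x t → (A ⊗ (λ y z → Σ≤ (suc k) (λ j → N j y z))) x t ≡
          + 3 * Σ≤ k (λ j → N j x t) + N (suc k) x t + N (2 ℕ.+ k) x t
    A⊗Σ zero x t = trans (trans (sum-cong-≗ (λ w → ℤ.*-distribˡ-+ (A x w) (N 0 w t) (N 1 w t)))
        (∑-distrib-+ (λ w → A x w * N 0 w t) (λ w → A x w * N 1 w t)))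
      (trans (cong (λ s → N 1 x t + s) (AN₁ x t)) (lemma (N 0 x t) (N 1 x t) (N 2 x t)))
      where
      lemma : ∀ a b c → b + (c + + 3 * a) ≡ + 3 * a + b + c
      lemma = solve-∀
    A⊗Σ (suc k) x t = trans (trans (sum-cong-≗ (λ w → ℤ.*-distribˡ-+ (A x w) (Σ≤ (suc k) (λ j → N j w t)) (N (2 ℕ.+ k) w t)))
        (∑-distrib-+ (λ w → A x w * Σ≤ (suc k) (λ j → N j w t)) (λ w → A x w * N (2 ℕ.+ k) w t)))
      (trans (cong₂ _+_ (A⊗Σ k x t) (AN k x t)) (lemma (Σ≤ k (λ j → N j x t)) (N (suc k) x t) (N (2 ℕ.+ k) x t) (N (3 ℕ.+ k) x t)))
      where
      lemma : ∀ s a b c → + 3 * s + a + b + (c + + 2 * a) ≡ + 3 * (s + a) + b + c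
      lemma = solve-∀

    module Total (d′ : ℕ) (total : ∀ x t → Σ≤ (suc d′) (λ k → N k x t) ≡ 1ℤ) where

      -- `A` times the all-ones matrix is 3 everywhere. Comparing this with `A⊗Σ` leaves only the
      -- two matrices of highest index.
      top : ∀ x t → N (2 ℕ.+ d′) x t ≡ + 2 * N (suc d′) x t
      top x t = ∙-cancelˡ (+ 3 * below + a) (N (2 ℕ.+ d′) x t) (+ 2 * a)
        (trans (sym (A⊗Σ d′ x t)) (trans (sum-cong-≗ (λ w → trans (cong (A x w *_) (total w t)) (ℤ.*-identityʳ (A x w))))
          (trans (A-row x) (trans (cong (+ 3 *_) (sym (total x t))) (lemma below a)))))
        where
        below = Σ≤ d′ (λ k → N k x t)
        a = N (suc d′) x t
        lemma : ∀ s a → + 3 * (s + a) ≡ + 3 * s + a + + 2 * a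
        lemma = solve-∀

      order : Fin n → + n ≡ + 3 * pow2 (suc d′) - + 2
      order x = trans (sym (trans (sum-const n 1ℤ) (ℤ.*-identityʳ (+ n)))) (trans (sum-cong-≗ (λ t → sym (total x t)))
        (trans (sum-Σ≤ (suc d′) (λ k t → N k x t)) (trans (Σ≤-cong-≡ (suc d′) (λ k _ → N-row k x)) (Σκ (suc d′)))))

  -- Walk counts under the girth condition

  module MooreGraph {n : ℕ} (Γ : Graph n) (cubic : ∀ v → degree Γ v ≡ 3) (e : ℕ)
    (acyclic : ∀ k → k ℕ.< 2 ℕ.* suc e ℕ.+ 1 → HasCycleOfLength Γ k → ⊥) where

    open Ball Γ cubic e acyclic public
    open WalkCount Γ cubic public

    A-~ : ∀ {x y} → x ~ y → A x y ≡ 1ℤ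
    A-~ {x} {y} x~y with adj Γ x y
    ... | true = refl

    A-≁ : ∀ {x y} → ¬ x ~ y → A x y ≡ 0ℤ
    A-≁ {x} {y} x≁y with adj Γ x y
    ... | true  = contradiction tt x≁y
    ... | false = refl

    adjacent? : ∀ x y → x ~ y ⊎ ¬ x ~ y
    adjacent? x y with adj Γ x y
    ... | true  = inj₁ tt
    ... | false = inj₂ (λ ())

    Walk-step : ∀ {x k t} → Walk x (suc k) t → ∃ λ w → x ~ w × Away x w k t
    Walk-step (w ∷ l , len , nb , last) = w , NB-head nb , l , ℕ.suc-injective len , nb , last

    Away-cons : ∀ {p v w k t} → p ~ v → w ≢ p → Away v w k t → Away p v (suc k) t
    Away-cons p~v w≢p (l , len , nb , last) = _ ∷ l , cong suc len , cons p~v (≢-sym w≢p) nb , last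

    Away-step : ∀ {p v k t} → Away p v (suc k) t → ∃ λ w → v ~ w × w ≢ p × Away v w k t
    Away-step (w ∷ l , len , nb , last) = w , NB-head (NB-tail nb) , ≢-sym (NB-off nb) , l , ℕ.suc-injective len , NB-tail nb , last

    Away-first : ∀ {v w w′ k t} → k ℕ.< d → Away v w k t → Away v w′ k t → w ≡ w′
    Away-first {v} {w} {w′} k<d (l , len , nb , last) (l′ , len′ , nb′ , last′) = List.∷-injectiveˡ (Walk-unique
      (w ∷ l , cong suc len , nb , last) (w′ ∷ l′ , cong suc len′ , nb′ , last′) (ℕ.≤-trans (s≤s (ℕ.+-mono-≤ k<d k<d)) d+d<g))
      where import Data.List.Properties as List

    step-zero : ∀ {a b c} → b ≡ 0ℤ ⊎ c ≡ 0ℤ → a * b * c ≡ 0ℤ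
    step-zero {a} {c = c} (inj₁ refl) = trans (cong (_* c) (ℤ.*-zeroʳ a)) (ℤ.*-zeroˡ c)
    step-zero {a} {b} (inj₂ refl) = ℤ.*-zeroʳ (a * b)

    W-none : ∀ k {p v t} → p ~ v → ¬ Away p v k t → W k p v t ≡ 0ℤ
    W-none zero    {p} {v} {t} p~v none = δ-≢ λ { refl → none ([] , refl , cons p~v tt [-] , refl) }
    W-none (suc k) {p} {v} {t} p~v none = sum-zero term
      where
      term : ∀ w → A v w * (1ℤ - δ w p) * W k v w t ≡ 0ℤ
      term w with adjacent? v w
      ... | inj₂ v≁w = trans (cong (λ a → a * (1ℤ - δ w p) * W k v w t) (A-≁ v≁w)) (ℤ.*-zeroˡ (W k v w t))
      ... | inj₁ v~w with w ≟ p
      ...   | yes refl = step-zero {A v w} (inj₁ refl)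
      ...   | no w≢p = step-zero {A v w} (inj₂ (W-none k v~w (λ away → none (Away-cons p~v w≢p away))))

    -- Walks of equal length at most `d` with the same ends coincide, so in the recursion for `W`
    -- only the summand of the actual first step survives.
    W-one : ∀ k {p v t} → k ℕ.≤ d → p ~ v → Away p v k t → W k p v t ≡ 1ℤ
    W-one zero    {v = v} _ p~v ([] , _ , _ , refl) = δ-refl v
    W-one (suc k) {p} {v} {t} k<d p~v away with Away-step away
    ... | w , v~w , w≢p , rest = trans (sum-single w other)
      (trans (cong₂ (λ a b → a * (1ℤ - b) * W k v w t) (A-~ v~w) (δ-≢ w≢p)) (trans (cong (λ c → 1ℤ * c) (W-one k (ℕ.<⇒≤ k<d) v~w rest)) refl))
      where
      other : ∀ w′ → w′ ≢ w → A v w′ * (1ℤ - δ w′ p) * W k v w′ t ≡ 0ℤ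
      other w′ w′≢w with adjacent? v w′
      ... | inj₂ v≁w′ = trans (cong (λ a → a * (1ℤ - δ w′ p) * W k v w′ t) (A-≁ v≁w′)) (ℤ.*-zeroˡ (W k v w′ t))
      ... | inj₁ v~w′ = step-zero {A v w′} (inj₂ (W-none k v~w′ (λ away′ → w′≢w (Away-first k<d away′ rest))))

    N-none : ∀ k {x t} → ¬ Walk x k t → N k x t ≡ 0ℤ
    N-none zero    none = δ-≢ λ { refl → none ([] , refl , [-] , refl) }
    N-none (suc k) {x} {t} none = sum-zero term
      where
      term : ∀ w → A x w * W k x w t ≡ 0ℤ
      term w with adjacent? x w
      ... | inj₂ x≁w = trans (cong (_* W k x w t) (A-≁ x≁w)) (ℤ.*-zeroˡ (W k x w t))
      ... | inj₁ x~w = trans (cong (A x w *_) (W-none k x~w (λ { (l , len , nb , last) → none (w ∷ l , cong suc len , nb , last) }))) (ℤ.*-zeroʳ (A x w))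

    N-one : ∀ k {x t} → k ℕ.≤ d → Walk x k t → N k x t ≡ 1ℤ
    N-one zero    {x} _ ([] , _ , _ , refl) = δ-refl x
    N-one (suc k) {x} {t} k<d walk with Walk-step walk
    ... | w , x~w , rest = trans (sum-single w other) (trans (cong₂ _*_ (A-~ x~w) (W-one k (ℕ.<⇒≤ k<d) x~w rest)) refl)
      where
      other : ∀ w′ → w′ ≢ w → A x w′ * W k x w′ t ≡ 0ℤ
      other w′ w′≢w with adjacent? x w′
      ... | inj₂ x≁w′ = trans (cong (_* W k x w′ t) (A-≁ x≁w′)) (ℤ.*-zeroˡ (W k x w′ t))
      ... | inj₁ x~w′ = trans (cong (A x w′ *_) (W-none k x~w′ (λ away → w′≢w (Away-first k<d away rest)))) (ℤ.*-zeroʳ (A x w′))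

    Walk-length : ∀ {x t j k} → j ℕ.≤ d → k ℕ.≤ d → Walk x j t → Walk x k t → j ≡ k
    Walk-length j≤d k≤d p q = trans (sym (proj₁ (proj₂ p))) (trans (cong length (Walk-unique p q (ℕ.≤-trans (s≤s (ℕ.+-mono-≤ j≤d k≤d)) d+d<g))) (proj₁ (proj₂ q)))

    N-diagonal : ∀ k → suc k ℕ.≤ d → ∀ x → N (suc k) x x ≡ 0ℤ
    N-diagonal k k<d x = N-none (suc k) λ walk → contradiction (Walk-length z≤n k<d ([] , refl , [-] , refl) walk) λ ()

    module Diameter (near : ∀ x t → Near d x t) where

      -- `near` provides a walk of some length at most `d`, and by `Walk-length` no other such
      -- length occurs.
      N-total : ∀ x t → Σ≤ d (λ k → N k x t) ≡ 1ℤ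
      N-total x t with near x t
      ... | k , k≤d , walk = trans (Σ≤-single d k k≤d (λ j j≤d j≢k → N-none j (λ walk′ → j≢k (Walk-length j≤d k≤d walk′ walk)))) (N-one k k≤d walk)

      open Total e N-total public

  injective⇒surjective : ∀ {n} (f : Fin n → Fin n) → (∀ {i j} → f i ≡ f j → i ≡ j) → ∀ j → ∃ λ i → j ≡ f i
  injective⇒surjective {n} f inj j with ∈.∈-map⁻ f (Unique⊆⇒⊇ _≟_ (Unique.map⁺ inj (Unique.allFin⁺ n)) (λ {x} _ → ∈.∈-allFin x)
    (ℕ.≤-reflexive (sym (List.length-map f (allFin n)))) (∈.∈-allFin j))
  ... | i , _ , eq = i , eq

  -- The Petersen graph built around a pentagon

  next : Fin 5 → Fin 5
  next 0F = 1F
  next 1F = 2F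
  next 2F = 3F
  next 3F = 4F
  next 4F = 0F

  prev : Fin 5 → Fin 5
  prev = next ∘ next ∘ next ∘ next

  next-prev : ∀ i → next (prev i) ≡ i
  next-prev = toWitness {a? = Fin.all? (λ i → next (prev i) ≟ i)} tt

  -- Both composites unfold to five applications of `next`.
  prev-next : ∀ i → prev (next i) ≡ i
  prev-next = next-prev

  -- The three neighbours of a vertex of the Petersen graph, with `inj₁` for the outer pentagon and
  -- `inj₂` for the pentagram; two steps back are written as three steps forward.
  link₁ link₂ link₃ : Fin 5 ⊎ Fin 5 → Fin 5 ⊎ Fin 5
  link₁ = [ inj₁ ∘ prev , inj₁ ]′
  link₂ = [ inj₁ ∘ next , inj₂ ∘ next ∘ next ]′
  link₃ = [ inj₂ , inj₂ ∘ next ∘ next ∘ next ]′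

  onFin10 : (Fin 5 ⊎ Fin 5 → Fin 5 ⊎ Fin 5) → Fin 10 → Fin 10
  onFin10 f i = join 5 5 (f (splitAt 5 i))

  Petersen-adj : ∀ i j → adj Petersen i j ≡ ⌊ j ≟ onFin10 link₁ i ⌋ ∨ ⌊ j ≟ onFin10 link₂ i ⌋ ∨ ⌊ j ≟ onFin10 link₃ i ⌋
  Petersen-adj = toWitness {a? = Fin.all? λ i → Fin.all? λ j →
    adj Petersen i j Bool.≟ (⌊ j ≟ onFin10 link₁ i ⌋ ∨ ⌊ j ≟ onFin10 link₂ i ⌋ ∨ ⌊ j ≟ onFin10 link₃ i ⌋)} tt

  module Girth5 {n : ℕ} (Γ : Graph n) (cubic : ∀ v → degree Γ v ≡ 3)
    (acyclic : ∀ k → k ℕ.< 5 → HasCycleOfLength Γ k → ⊥) where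

    open Ball Γ cubic 1 acyclic

    no-triangle : ∀ {a b c} → a ~ b → b ~ c → c ~ a → ⊥
    no-triangle ab bc ca = NB-open (cons ab (≢-sym (~⇒≢ ca)) (cons bc (≢-sym (~⇒≢ ab)) (cons ca tt [-]))) (ℕ.n≤1+n 4) refl

    no-square : ∀ {a b c d} → a ~ b → b ~ c → c ~ d → d ~ a → a ≢ c → b ≢ d → ⊥
    no-square ab bc cd da a≢c b≢d = NB-open (cons ab a≢c (cons bc b≢d (cons cd (≢-sym a≢c) (cons da tt [-])))) ℕ.≤-refl refl

    all-neighbours : ∀ {v a b c} → v ~ a → v ~ b → v ~ c → a ≢ b → a ≢ c → b ≢ c → ∀ {w} → v ~ w → w ≡ a ⊎ w ≡ b ⊎ w ≡ c
    all-neighbours {v} {a} {b} va vb vc a≢b a≢c b≢c {w} vw with w ≟ a | w ≟ b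
    ... | yes w≡a | _       = inj₁ w≡a
    ... | no _    | yes w≡b = inj₂ (inj₁ w≡b)
    ... | no w≢a  | no w≢b  = inj₂ (inj₂ (third va vb vw vc (≢-sym a≢b) w≢a (≢-sym a≢c) w≢b (≢-sym b≢c)))

    third-neighbour : ∀ {v a b} → v ~ a → v ~ b → a ≢ b → ∃ λ c → v ~ c × c ≢ a × c ≢ b
    third-neighbour va vb a≢b with others va
    ... | O with Others.only O vb
    ...   | inj₁ b≡a         = contradiction (sym b≡a) a≢b
    ...   | inj₂ (inj₁ refl) = Others.b O , Others.v~b O , ≢-sym (Others.p≢b O) , ≢-sym (Others.a≢b O)
    ...   | inj₂ (inj₂ refl) = Others.a O , Others.v~a O , ≢-sym (Others.p≢a O) , Others.a≢b O

    module Pentagon (near : ∀ a b → Near 2 a b) (x : Fin 5 → V) (x~ : ∀ i → x i ~ x (next i))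
      (x≢ : ∀ i → x (prev i) ≢ x (next i)) where

      x~prev : ∀ i → x i ~ x (prev i)
      x~prev i = ~-sym (subst (λ j → x (prev i) ~ x j) (next-prev i) (x~ (prev i)))

      y : Fin 5 → V
      y i = proj₁ (third-neighbour (x~prev i) (x~ i) (x≢ i))

      x~y : ∀ i → x i ~ y i
      x~y i = proj₁ (proj₂ (third-neighbour (x~prev i) (x~ i) (x≢ i)))

      y≢prev : ∀ i → y i ≢ x (prev i)
      y≢prev i = proj₁ (proj₂ (proj₂ (third-neighbour (x~prev i) (x~ i) (x≢ i))))

      y≢next : ∀ i → y i ≢ x (next i)
      y≢next i = proj₂ (proj₂ (proj₂ (third-neighbour (x~prev i) (x~ i) (x≢ i))))

      around-x : ∀ i {w} → x i ~ w → w ≡ x (prev i) ⊎ w ≡ x (next i) ⊎ w ≡ y i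
      around-x i = all-neighbours (x~prev i) (x~ i) (x~y i) (x≢ i) (≢-sym (y≢prev i)) (≢-sym (y≢next i))

      around-x₂ : ∀ i {w} → x (next (next i)) ~ w → w ≡ x (next i) ⊎ w ≡ x (next (next (next i))) ⊎ w ≡ y (next (next i))
      around-x₂ i {w} e with around-x (next (next i)) e
      ... | inj₁ w≡ = inj₁ (trans w≡ (cong x (prev-next (next i))))
      ... | inj₂ w≡ = inj₂ w≡

      -- y i and x (i + 2) are at distance two, and only y (i + 2) can be between them.
      y~y : ∀ i → y i ~ y (next (next i))
      y~y i with near (y i) (x (next (next i)))
      ... | 0 , _ , [] , _ , _ , y≡x = contradiction (subst (x i ~_) y≡x (x~y i)) λ x~x₂ → no-triangle (x~ i) (x~ (next i)) (~-sym x~x₂)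
      ... | 1 , _ , w ∷ [] , _ , nb , refl with around-x₂ i (~-sym (NB-head nb))
      ...   | inj₁ y≡x₁        = contradiction y≡x₁ (y≢next i)
      ...   | inj₂ (inj₁ y≡x₃) = ⊥-elim (no-triangle (x~ (next (next (next i)))) (subst (x (prev i) ~_) (cong x (next-prev i)) (x~ (prev i))) (subst (x i ~_) y≡x₃ (x~y i)))
      ...   | inj₂ (inj₂ y≡y₂) = ⊥-elim (no-square (x~ i) (x~ (next i)) (x~y (next (next i))) (subst (_~ x i) y≡y₂ (~-sym (x~y i))) (x≢₂ i) (λ eq → y≢next i (trans y≡y₂ (sym eq))))
        where
        x≢₂ : ∀ i → x i ≢ x (next (next i))
        x≢₂ i = subst (λ j → x j ≢ x (next (next i))) (prev-next i) (x≢ (next i))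
      y~y i | 2 , _ , z ∷ w ∷ [] , _ , nb , refl with around-x₂ i (~-sym (NB-head (NB-tail nb)))
      ... | inj₁ refl        = ⊥-elim (no-triangle (x~ i) (~-sym (NB-head nb)) (~-sym (x~y i)))
      ... | inj₂ (inj₁ refl) = ⊥-elim (no-square (x~y i) (NB-head nb) (x~ (next (next (next i)))) (subst (x (prev i) ~_) (cong x (next-prev i)) (x~ (prev i)))
              (λ eq → x≢ (prev i) (trans (cong (x ∘ next ∘ next ∘ next) (next-prev i)) (trans (sym eq) (cong x (sym (next-prev i)))))) (y≢prev i))
      ... | inj₂ (inj₂ refl) = NB-head nb
      y~y i | suc (suc (suc _)) , s≤s (s≤s ()) , _

      y~y₃ : ∀ i → y i ~ y (next (next (next i)))
      y~y₃ i = ~-sym (subst (λ j → y (next (next (next i))) ~ y j) (next-prev i) (y~y (next (next (next i)))))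

      x≢y₂ : ∀ i → x i ≢ y (next (next i))
      x≢y₂ i eq = no-triangle (x~ i) (x~ (next i)) (subst (x (next (next i)) ~_) (sym eq) (x~y (next (next i))))

      x≢y₃ : ∀ i → x i ≢ y (next (next (next i)))
      x≢y₃ i eq = no-triangle (x~ (next (next (next i)))) (subst (x (prev i) ~_) (cong x (next-prev i)) (x~ (prev i)))
        (~-sym (subst (x (next (next (next i))) ~_) (sym eq) (x~y (next (next (next i))))))

      y≢y₁ : ∀ i → y i ≢ y (next i)
      y≢y₁ i eq = no-triangle (x~ i) (subst (x (next i) ~_) (sym eq) (x~y (next i))) (~-sym (x~y i))

      around-y : ∀ i {w} → y i ~ w → w ≡ x i ⊎ w ≡ y (next (next i)) ⊎ w ≡ y (next (next (next i)))
      around-y i = all-neighbours (~-sym (x~y i)) (y~y i) (y~y₃ i) (x≢y₂ i) (x≢y₃ i) (y≢y₁ (next (next i)))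

      xy : Fin 5 ⊎ Fin 5 → V
      xy = [ x , y ]′

      xy-around : ∀ s {w} → xy s ~ w → w ≡ xy (link₁ s) ⊎ w ≡ xy (link₂ s) ⊎ w ≡ xy (link₃ s)
      xy-around (inj₁ i) = around-x i
      xy-around (inj₂ i) = around-y i

      xy-linked : ∀ s → xy s ~ xy (link₁ s) × xy s ~ xy (link₂ s) × xy s ~ xy (link₃ s)
      xy-linked (inj₁ i) = x~prev i , x~ i , x~y i
      xy-linked (inj₂ i) = ~-sym (x~y i) , y~y i , y~y₃ i

      φ : Fin 10 → V
      φ = xy ∘ splitAt 5

      φ-link : ∀ f i → xy (f (splitAt 5 i)) ≡ φ (onFin10 f i)
      φ-link f i = cong xy (sym (Fin.splitAt-join 5 5 (f (splitAt 5 i))))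

      φ-around : ∀ i {w} → φ i ~ w → w ≡ φ (onFin10 link₁ i) ⊎ w ≡ φ (onFin10 link₂ i) ⊎ w ≡ φ (onFin10 link₃ i)
      φ-around i e with xy-around (splitAt 5 i) e
      ... | inj₁ w≡        = inj₁ (trans w≡ (φ-link link₁ i))
      ... | inj₂ (inj₁ w≡) = inj₂ (inj₁ (trans w≡ (φ-link link₂ i)))
      ... | inj₂ (inj₂ w≡) = inj₂ (inj₂ (trans w≡ (φ-link link₃ i)))

      φ-linked : ∀ i → φ i ~ φ (onFin10 link₁ i) × φ i ~ φ (onFin10 link₂ i) × φ i ~ φ (onFin10 link₃ i)
      φ-linked i with xy-linked (splitAt 5 i)
      ... | e₁ , e₂ , e₃ = subst (φ i ~_) (φ-link link₁ i) e₁ , subst (φ i ~_) (φ-link link₂ i) e₂ , subst (φ i ~_) (φ-link link₃ i) e₃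

      -- By `φ-around` the image of `φ` contains every neighbour of its vertices, so connectedness
      -- makes it everything.
      φ-onto : Connected Γ → ∀ v → ∃ λ i → φ i ≡ v
      φ-onto connected v = along (connected (φ zero) v) (zero , refl)
        where
        along : ∀ {a b} → Reach Γ a b → (∃ λ i → φ i ≡ a) → ∃ λ i → φ i ≡ b
        along here       a = a
        along (step e r) (i , refl) with φ-around i e
        ... | inj₁ w≡        = along r (onFin10 link₁ i , sym w≡)
        ... | inj₂ (inj₁ w≡) = along r (onFin10 link₂ i , sym w≡)
        ... | inj₂ (inj₂ w≡) = along r (onFin10 link₃ i , sym w≡)

      -- Injectivity is a hypothesis because it follows from surjectivity only once `n` is known to
      -- be 10.
      φ-adj : (∀ {i j} → φ i ≡ φ j → i ≡ j) → ∀ i j → adj Petersen i j ≡ adj Γ (φ i) (φ j)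
      φ-adj inj i j = trans (Petersen-adj i j) (check (onFin10 link₁ i) (onFin10 link₂ i) (onFin10 link₃ i) (φ-linked i) (φ-around i))
        where
        true≡ : ∀ {b} → T b → true ≡ b
        true≡ {true} _ = refl
        check : ∀ p q r → φ i ~ φ p × φ i ~ φ q × φ i ~ φ r → (∀ {w} → φ i ~ w → w ≡ φ p ⊎ w ≡ φ q ⊎ w ≡ φ r) →
                ⌊ j ≟ p ⌋ ∨ ⌊ j ≟ q ⌋ ∨ ⌊ j ≟ r ⌋ ≡ adj Γ (φ i) (φ j)
        check p q r (ep , eq , er) around with j ≟ p | j ≟ q | j ≟ r
        ... | yes refl | _        | _        = true≡ ep
        ... | no _     | yes refl | _        = true≡ eq
        ... | no _     | no _     | yes refl = true≡ er
        ... | no j≢p   | no j≢q   | no j≢r with adj Γ (φ i) (φ j) in e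
        ...   | false = refl
        ...   | true with around (subst T (sym e) tt)
        ...     | inj₁ eq        = contradiction (inj eq) j≢p
        ...     | inj₂ (inj₁ eq) = contradiction (inj eq) j≢q
        ...     | inj₂ (inj₂ eq) = contradiction (inj eq) j≢r

  -- A section of `φ` is injective, hence surjective on ten elements, hence a two-sided inverse.
  isoPetersen : (Γ : Graph 10) → (φ : Fin 10 → Fin 10) → (∀ v → ∃ λ i → φ i ≡ v) →
    ((∀ {i j} → φ i ≡ φ j → i ≡ j) → ∀ i j → adj Petersen i j ≡ adj Γ (φ i) (φ j)) → Γ ≅ Petersen
  isoPetersen Γ φ onto preserves = mk↔ₛ′ φ⁻¹ φ φ⁻¹φ φφ⁻¹ , λ x y → trans (preserves φ-injective (φ⁻¹ x) (φ⁻¹ y)) (cong₂ (adj Γ) (φφ⁻¹ x) (φφ⁻¹ y))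
    where
    φ⁻¹ : Fin 10 → Fin 10
    φ⁻¹ v = proj₁ (onto v)
    φφ⁻¹ : ∀ v → φ (φ⁻¹ v) ≡ v
    φφ⁻¹ v = proj₂ (onto v)
    φ⁻¹φ : ∀ i → φ⁻¹ (φ i) ≡ i
    φ⁻¹φ i with injective⇒surjective φ⁻¹ (λ {v} {w} eq → trans (sym (φφ⁻¹ v)) (trans (cong φ eq) (φφ⁻¹ w))) i
    ... | v , refl = cong φ⁻¹ (φφ⁻¹ v)
    φ-injective : ∀ {i j} → φ i ≡ φ j → i ≡ j
    φ-injective {i} {j} eq = trans (sym (φ⁻¹φ i)) (trans (cong φ⁻¹ eq) (φ⁻¹φ j))

  K4-iso : (Γ : Graph 4) → (∀ x t → x ≢ t → T (adj Γ x t)) → Γ ≅ K4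
  K4-iso Γ complete = ↔-id (Fin 4) , same
    where
    same : ∀ x y → not ⌊ x ≟ y ⌋ ≡ adj Γ x y
    same x y with x ≟ y
    ... | yes refl = sym (adj-irrefl Γ x)
    ... | no x≢y   = sym (Equivalence.to T-≡ (complete x y x≢y))

  pentagon : ∀ {n} (Γ : Graph n) → HasCycleOfLength Γ 5 →
    ∃ λ (x : Fin 5 → Fin n) → (∀ i → T (adj Γ (x i) (x (next i)))) × (∀ i → x (prev i) ≢ x (next i))
  pentagon {n} Γ (a ∷ b ∷ c ∷ d ∷ e ∷ [] , refl , cyc) with Equivalence.to (T-∧ {allDistinct Γ (a ∷ b ∷ c ∷ d ∷ e ∷ [])}) cyc
  ... | distinct , closed with Walks.allDistinct⇒Unique Γ (a ∷ b ∷ c ∷ d ∷ e ∷ []) distinct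
  ...   | (a≢b ∷ a≢c ∷ a≢d ∷ a≢e ∷ []) ∷ (b≢c ∷ b≢d ∷ b≢e ∷ []) ∷ (c≢d ∷ c≢e ∷ []) ∷ (d≢e ∷ []) ∷ _ = x , edges , apart
    where
    x : Fin 5 → Fin n
    x 0F = a
    x 1F = b
    x 2F = c
    x 3F = d
    x 4F = e
    ab = Equivalence.to (T-∧ {adj Γ a b}) closed
    bc = Equivalence.to (T-∧ {adj Γ b c}) (proj₂ ab)
    cd = Equivalence.to (T-∧ {adj Γ c d}) (proj₂ bc)
    de = Equivalence.to (T-∧ {adj Γ d e}) (proj₂ cd)
    ea = Equivalence.to (T-∧ {adj Γ e a}) (proj₂ de)
    edges : ∀ i → T (adj Γ (x i) (x (next i)))
    edges 0F = proj₁ ab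
    edges 1F = proj₁ bc
    edges 2F = proj₁ cd
    edges 3F = proj₁ de
    edges 4F = proj₁ ea
    apart : ∀ i → x (prev i) ≢ x (next i)
    apart 0F = ≢-sym b≢e
    apart 1F = a≢c
    apart 2F = b≢d
    apart 3F = c≢e
    apart 4F = ≢-sym a≢d

  cycle-vertex : ∀ {n k} {Γ : Graph n} → HasCycleOfLength Γ k → Fin n
  cycle-vertex (a ∷ _ , _) = a

  module Signature {n : ℕ} (Γ : Graph n) (e a₁ a₂ : ℕ) (connected : Connected Γ) (cubic : ∀ v → degree Γ v ≡ 3)
    (acyclic : ∀ k → k ℕ.< 2 ℕ.* suc e ℕ.+ 1 → HasCycleOfLength Γ k → ⊥)
    (signature : ∀ v → edgeCounts Γ (2 ℕ.* suc e ℕ.+ 1) v ↭ (a₁ ∷ a₂ ∷ 2 ℕ.^ suc e ∷ [])) where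

    open MooreGraph Γ cubic e acyclic public

    mate : ∀ u → ∃ (Full u)
    mate u with ∈.∈-map⁻ (ε Γ g u) (∈-resp-↭ (↭-sym (signature u)) (there (there (here refl))))
    ... | v , v∈ , many = v , full (∈-neighbours⁻ v∈) (ℕ.≤-reflexive many)

    open Matched mate using (near) public
    open Diameter (near connected) public

    walk-multiplicity : Fin n → Multiplicity e n
    walk-multiplicity o u odd K s root T≡ s-odd = Moore.multiplicity A N e (λ _ _ → refl) (λ x t → sum-*δ (A x) t) (λ _ _ → refl) AN₁ AN
      top N-total N-diagonal (reversed u (suc e)) u (λ k → ψ-odd odd (suc e ℕ.∸ k)) (reversed-rec u (suc e)) (reversed-last u e)
      o K s root (trans (reversed-squares u (suc e)) T≡) s-odd

open import Data.Nat using (ℕ; suc; _+_; _*_; _^_; _≤_; z≤n; s≤s)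
import Data.Integer.Properties as ℤ
open import Data.Bool using (T)

theorem1p4 : (n : ℕ) (Γ : Graph n) (d : ℕ) (a₁ a₂ : ℕ) →
    Connected Γ →
    (∀ v → degree Γ v ≡ 3) →
    HasGirth Γ (2 * d + 1) →
    a₁ ≤ a₂ → a₂ ≤ 2 ^ d →
    (∀ v → edgeCounts Γ (2 * d + 1) v ↭ (a₁ ∷ a₂ ∷ 2 ^ d ∷ [])) →
    (Γ ≅ K4) ⊎ (Γ ≅ Petersen)
theorem1p4 n Γ 0 _ _ _ _ ((_ ∷ [] , refl , ()) , _) _ _ _
theorem1p4 n Γ 1 a₁ a₂ connected cubic (cycle , acyclic) _ _ signature =
  inj₁ (iso (ℤ.+-injective (order (cycle-vertex {Γ = Γ} cycle))))
  where
  open Signature Γ 0 a₁ a₂ connected cubic acyclic signature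
  complete : ∀ x t → x ≢ t → T (adj Γ x t)
  complete x t x≢t with near connected x t
  ... | 0 , _ , [] , _ , _ , x≡t         = contradiction x≡t x≢t
  ... | 1 , _ , _ ∷ [] , _ , nb , refl   = NB-head nb
  ... | suc (suc _) , s≤s () , _
  iso : n ≡ 4 → Γ ≅ K4
  iso refl = K4-iso Γ complete
theorem1p4 n Γ 2 a₁ a₂ connected cubic (cycle , acyclic) _ _ signature =
  inj₂ (iso (ℤ.+-injective (order (cycle-vertex {Γ = Γ} cycle))))
  where
  open Signature Γ 1 a₁ a₂ connected cubic acyclic signature
  open Girth5.Pentagon Γ cubic acyclic (near connected) (proj₁ (pentagon Γ cycle))
    (proj₁ (proj₂ (pentagon Γ cycle))) (proj₂ (proj₂ (pentagon Γ cycle))) using (φ; φ-onto; φ-adj)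
  iso : n ≡ 10 → Γ ≅ Petersen
  iso refl = isoPetersen Γ φ (φ-onto connected) φ-adj
theorem1p4 n Γ (suc (suc (suc e))) a₁ a₂ connected cubic (cycle , acyclic) _ _ signature =
  contradiction (walk-multiplicity o) (no-moore-multiplicity (2 + e) n (s≤s (s≤s z≤n)) (order o))
  where
  o : Fin n
  o = cycle-vertex {Γ = Γ} cycle
  open Signature Γ (2 + e) a₁ a₂ connected cubic acyclic signature
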